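{- Let $G$ be a forest on $n$ vertices with no isolated vertices. Then $\operatorname{avd}(G)\leq \frac{2n}{3}$. Moreover, equality holds if and only if every non-leaf vertex of $G$ is a support vertex with one or two leaf neighbors.
   Context: All graphs are finite, simple and undirected. A set $S\subseteq V(G)$ is a dominating set of $G$ if every vertex of $V(G)\setminus S$ is adjacent to some vertex of $S$. Let $\mathcal{D}(G)$ be the family of all dominating sets of $G$. The average order of a dominating set of $G$ is $\operatorname{avd}(G)=\frac{\sum_{S\in\mathcal{D}(G)}|S|}{|\mathcal{D}(G)|}$. A leaf is a vertex of degree one; a support vertex is a vertex adjacent to at least one leaf; the leaf neighbors of a vertex are the leaves adjacent to it. -}

module Defs where

open import Data.Bool using (Bool; true; false; _∧_; _∨_; if_then_else_)
open import Data.Nat using (ℕ; zero; suc; _+_; _*_; _≤_)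
open import Data.Fin using (Fin; zero; suc)
open import Data.List using (List; []; _∷_; length; filterᵇ; map; concatMap; allFin)
open import Data.Bool.ListAction using (all; any)
open import Data.Nat.ListAction using (sum)
open import Data.List.Relation.Unary.Unique.Propositional using (Unique)
open import Data.Product using (Σ; _×_; ∃)
open import Data.Integer using (+_)
open import Data.Rational using (ℚ; _/_; 0ℚ)
open import Relation.Binary.PropositionalEquality using (_≡_)
open import Relation.Nullary using (¬_)

record Graph (n : ℕ) : Set where
  field
    adj   : Fin n → Fin n → Bool
    sym   : ∀ u v → adj u v ≡ adj v u
    irrefl : ∀ v → adj v v ≡ false
open Graph public

module _ {n : ℕ} (G : Graph n) where

  Walk : List (Fin n) → Set
  Walk []           = Data.Unit.⊤ where import Data.Unit
  Walk (x ∷ [])     = Data.Unit.⊤ where import Data.Unit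
  Walk (x ∷ y ∷ xs) = (adj G x y ≡ true) × Walk (y ∷ xs)

  lastOf : Fin n → List (Fin n) → Fin n
  lastOf x []       = x
  lastOf x (y ∷ ys) = lastOf y ys

  IsCycle : List (Fin n) → Set
  IsCycle []       = Data.Empty.⊥ where import Data.Empty
  IsCycle (x ∷ xs) = (3 ≤ length (x ∷ xs)) × Unique (x ∷ xs) × Walk (x ∷ xs)
                     × (adj G (lastOf x xs) x ≡ true)

  IsForest : Set
  IsForest = ∀ (c : List (Fin n)) → ¬ IsCycle c

  NoIsolated : Set
  NoIsolated = ∀ (v : Fin n) → ∃ λ u → adj G v u ≡ true

  degree : Fin n → ℕ
  degree v = length (filterᵇ (adj G v) (allFin n))

  isLeaf : Fin n → Bool
  isLeaf v with degree v
  ... | 1 = true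
  ... | _ = false

  IsLeaf : Fin n → Set
  IsLeaf v = degree v ≡ 1

  leafNeighbours : Fin n → ℕ
  leafNeighbours v = length (filterᵇ (λ u → adj G v u ∧ isLeaf u) (allFin n))

  IsSupport : Fin n → Set
  IsSupport v = 1 ≤ leafNeighbours v

  Subset : Set
  Subset = Fin n → Bool

  size : Subset → ℕ
  size S = length (filterᵇ S (allFin n))

  isDominating : Subset → Bool
  isDominating S = all (λ v → S v ∨ any (λ u → S u ∧ adj G u v) (allFin n)) (allFin n)

allSubsets : (n : ℕ) → List (Fin n → Bool)
allSubsets zero    = (λ ()) ∷ []
allSubsets (suc n) = concatMap (λ S → ext false S ∷ ext true S ∷ []) (allSubsets n)
  where
  ext : Bool → (Fin n → Bool) → Fin (suc n) → Bool
  ext b S zero    = b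
  ext b S (suc i) = S i

dominatingSets : {n : ℕ} → Graph n → List (Fin n → Bool)
dominatingSets {n} G = filterᵇ (isDominating G) (allSubsets n)

-- s / d as a rational (d = 0 never occurs for 𝒟(G), since V(G) dominates)
ratio : ℕ → ℕ → ℚ
ratio s zero    = 0ℚ
ratio s (suc d) = (+ s) / suc d

avd : {n : ℕ} → Graph n → ℚ
avd G = ratio (sum (map (size G) (dominatingSets G))) (length (dominatingSets G))

{-# OPTIONS --safe #-}
module Submission where

-- Give the weight 1 + ε to a vertex in S and 1 - 2ε to a vertex outside S, with ε² = 0.  The
-- weighted sum Z over all dominating sets S is then |𝒟| + ε ∑ (3|S| - 2n), so the theorem says that
-- the ε-part of Z is nonpositive, and determines when it vanishes.
--
-- More generally let each vertex v carry three weights: for v ∈ S, for v ∉ S already dominated by the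
-- pruned part hanging at v, and for v ∉ S still to be dominated.  A leaf ℓ at x can then be pruned by
-- changing the weights of x only.  Starting from a forest, three kinds of vertices occur:
--   fresh      nothing has been pruned at the vertex;
--   support j  j + 1 leaves have been pruned at the vertex (stars pruned there only give a scalar);
--   hub        only stars, joined to the vertex by their centres, have been pruned at the vertex.
-- Pruning a fresh or a support vertex leads to vertices of these kinds again, up to a scalar whose
-- ε-part is nonpositive.  When a hub ℓ is to be pruned, Z is linear in the weights of ℓ, and those are
-- a positive combination of the weights of "no vertex", of a leaf and of a support vertex with one
-- leaf, up to a correction which contributes a negative ε-part.  So induction on the number of
-- vertices applies, and a vertex which is neither a leaf nor a support vertex makes the inequality strict.

open import Defs
open import Algebra.Bundles using (CommutativeRing)
import Algebra.Properties.CommutativeMonoid.Sum as Sum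
open import Algebra.Structures using (IsCommutativeRing)
open import Data.Bool using (Bool; true; false; _∧_; _∨_; not; if_then_else_)
import Data.Bool as Bool
open import Data.Bool.ListAction using (all; any)
open import Data.Bool.Properties using (∧-commutativeMonoid; ∨-commutativeMonoid; ∧-zeroʳ; ∧-identityʳ; ∧-distribʳ-∨; ∨-identityʳ; ∨-zeroʳ; ∨-idem; ¬-not)
open import Data.Empty using (⊥-elim)
open import Data.Fin using (Fin; zero; suc; punchIn; punchOut; _≟_)
open import Data.Fin.Properties using (any?; injective⇒≤; punchIn-injective; punchIn-punchOut; punchInᵢ≢i)
open import Data.Integer using (ℤ; +_; 0ℤ; 1ℤ)
import Data.Integer as ℤ
import Data.Integer.Properties as ℤₚ
import Data.Integer.Tactic.RingSolver as ℤ-Solver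
open import Data.List using (List; []; _∷_; _++_; length; map; filterᵇ; concatMap; tabulate; allFin)
import Data.List as List
open import Data.List.Membership.Propositional using (_∈_)
open import Data.List.Membership.Propositional.Properties using (∈-∃++; ∈-lookup)
open import Data.List.Properties using (length-map; ++-assoc; length-++)
open import Data.List.Relation.Unary.All using (All; []; _∷_)
import Data.List.Relation.Unary.All as All
import Data.List.Relation.Unary.All.Properties as Allₚ
open import Data.List.Relation.Unary.AllPairs using ([]; _∷_)
open import Data.List.Relation.Unary.Unique.Propositional using (Unique)
import Data.List.Relation.Unary.Unique.Propositional.Properties as Uniqueₚ
open import Data.Maybe using (just; nothing)
open import Data.Nat using (ℕ; zero; suc; _*_; _≤_; _^_; z≤n; s≤s)
import Data.Nat as ℕ
open import Data.Nat.ListAction using () renaming (sum to sumᴸ)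
import Data.Nat.Properties as ℕₚ
open import Data.Product using (_×_; _,_; proj₁; proj₂; ∃)
open import Data.Rational using (ℚ; _/_)
import Data.Rational as Q
import Data.Rational.Properties as Qₚ
open import Data.Rational.Unnormalised using (mkℚᵘ; *≤*; *≡*)
import Data.Rational.Unnormalised.Properties as ℚᵘₚ
open import Data.Sum using (_⊎_; inj₁; inj₂)
open import Data.Unit using (⊤; tt)
open import Data.Vec using (Vec; []; _∷_; lookup; insertAt; _[_]≔_; replicate)
open import Data.Vec.Properties using (insertAt-lookup; insertAt-punchIn; lookup∘update′; lookup-replicate)
open import Function using (_∘_; id)
open import Function.Bundles using (_⇔_; mk⇔)
open import Level using (0ℓ)
open import Relation.Binary.PropositionalEquality using (_≡_; _≢_; _≗_; refl; cong; cong₂; trans; subst; subst₂; isEquivalence; module ≡-Reasoning)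
import Relation.Binary.PropositionalEquality as ≡
open import Relation.Nullary using (¬_; yes; no; contradiction; does)
open import Relation.Nullary.Decidable using (_×-dec_; ¬?)
open import Tactic.RingSolver using (solve-∀)
open import Tactic.RingSolver.Core.AlmostCommutativeRing using (AlmostCommutativeRing; fromCommutativeRing)

-- Dual numbers and weighted sums over vertex subsets

infixl 6 _⊕_
infixl 7 _⊛_

record Dual : Set where
  no-eta-equality
  pattern
  constructor _+ε_
  field re im : ℤ
open Dual

infix 5 _+ε_

_⊕_ _⊛_ : Dual → Dual → Dual
(a +ε b) ⊕ (c +ε d) = (a ℤ.+ c) +ε (b ℤ.+ d)
(a +ε b) ⊛ (c +ε d) = (a ℤ.* c) +ε (a ℤ.* d ℤ.+ b ℤ.* c)

⊖_ : Dual → Dual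
⊖ (a +ε b) = (ℤ.- a) +ε (ℤ.- b)

0ᴰ 1ᴰ : Dual
0ᴰ = 0ℤ +ε 0ℤ
1ᴰ = 1ℤ +ε 0ℤ

⊛-comm : ∀ x y → x ⊛ y ≡ y ⊛ x
⊛-comm (a +ε b) (c +ε d) = cong₂ _+ε_ (ℤₚ.*-comm a c) (lemma a b c d)
  where
  lemma : ∀ a b c d → a ℤ.* d ℤ.+ b ℤ.* c ≡ c ℤ.* b ℤ.+ d ℤ.* a
  lemma = ℤ-Solver.solve-∀

⊛-identityˡ : ∀ x → 1ᴰ ⊛ x ≡ x
⊛-identityˡ (a +ε b) = cong₂ _+ε_ (ℤₚ.*-identityˡ a) (lemma a b)
  where
  lemma : ∀ a b → 1ℤ ℤ.* b ℤ.+ 0ℤ ℤ.* a ≡ b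
  lemma = ℤ-Solver.solve-∀

⊛-distribˡ-⊕ : ∀ x y z → x ⊛ (y ⊕ z) ≡ x ⊛ y ⊕ x ⊛ z
⊛-distribˡ-⊕ (a +ε b) (c +ε d) (e +ε f) = cong₂ _+ε_ (ℤₚ.*-distribˡ-+ a c e) (lemma a b c d e f)
  where
  lemma : ∀ a b c d e f → a ℤ.* (d ℤ.+ f) ℤ.+ b ℤ.* (c ℤ.+ e) ≡ (a ℤ.* d ℤ.+ b ℤ.* c) ℤ.+ (a ℤ.* f ℤ.+ b ℤ.* e)
  lemma = ℤ-Solver.solve-∀

⊛-assoc : ∀ x y z → (x ⊛ y) ⊛ z ≡ x ⊛ (y ⊛ z)
⊛-assoc (a +ε b) (c +ε d) (e +ε f) = cong₂ _+ε_ (ℤₚ.*-assoc a c e) (lemma a b c d e f)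
  where
  lemma : ∀ a b c d e f → (a ℤ.* c) ℤ.* f ℤ.+ (a ℤ.* d ℤ.+ b ℤ.* c) ℤ.* e ≡ a ℤ.* (c ℤ.* f ℤ.+ d ℤ.* e) ℤ.+ b ℤ.* (c ℤ.* e)
  lemma = ℤ-Solver.solve-∀

dual-isCommutativeRing : IsCommutativeRing _≡_ _⊕_ _⊛_ ⊖_ 0ᴰ 1ᴰ
dual-isCommutativeRing = record
  { isRing = record
    { +-isAbelianGroup = record
      { isGroup = record
        { isMonoid = record
          { isSemigroup = record
            { isMagma = record { isEquivalence = isEquivalence ; ∙-cong = cong₂ _⊕_ }
            ; assoc = λ { (a +ε b) (c +ε d) (e +ε f) → cong₂ _+ε_ (ℤₚ.+-assoc a c e) (ℤₚ.+-assoc b d f) } }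
          ; identity = (λ { (a +ε b) → cong₂ _+ε_ (ℤₚ.+-identityˡ a) (ℤₚ.+-identityˡ b) })
                     , (λ { (a +ε b) → cong₂ _+ε_ (ℤₚ.+-identityʳ a) (ℤₚ.+-identityʳ b) }) }
        ; inverse = (λ { (a +ε b) → cong₂ _+ε_ (ℤₚ.+-inverseˡ a) (ℤₚ.+-inverseˡ b) })
                  , (λ { (a +ε b) → cong₂ _+ε_ (ℤₚ.+-inverseʳ a) (ℤₚ.+-inverseʳ b) })
        ; ⁻¹-cong = cong ⊖_ }
      ; comm = λ { (a +ε b) (c +ε d) → cong₂ _+ε_ (ℤₚ.+-comm a c) (ℤₚ.+-comm b d) } }
    ; *-cong = cong₂ _⊛_
    ; *-assoc = ⊛-assoc
    ; *-identity = ⊛-identityˡ , λ x → trans (⊛-comm x 1ᴰ) (⊛-identityˡ x)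
    ; distrib = ⊛-distribˡ-⊕
              , λ x y z → trans (⊛-comm (y ⊕ z) x) (trans (⊛-distribˡ-⊕ x y z) (cong₂ _⊕_ (⊛-comm x y) (⊛-comm x z))) }
  ; *-comm = ⊛-comm }

dual-commutativeRing : CommutativeRing 0ℓ 0ℓ
dual-commutativeRing = record { isCommutativeRing = dual-isCommutativeRing }

dual-ring : AlmostCommutativeRing 0ℓ 0ℓ
dual-ring = fromCommutativeRing dual-commutativeRing (λ { (ℤ.+0 +ε ℤ.+0) → just refl ; _ → nothing })

module Π = Sum (CommutativeRing.*-commutativeMonoid dual-commutativeRing)
module ⋁ = Sum ∨-commutativeMonoid

-- Subsets are bit vectors here, so that a vertex can be inserted at any index. The nesting follows
-- the recursion of `allSubsets`, on which `∑ˢ-allSubsets` relies.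
∑ˢ : ∀ n → (Vec Bool n → Dual) → Dual
∑ˢ zero    f = f []
∑ˢ (suc n) f = ∑ˢ n (λ S → f (false ∷ S) ⊕ f (true ∷ S))

∑ˢ-cong : ∀ n {f g : Vec Bool n → Dual} → (∀ S → f S ≡ g S) → ∑ˢ n f ≡ ∑ˢ n g
∑ˢ-cong zero    f≡g = f≡g []
∑ˢ-cong (suc n) f≡g = ∑ˢ-cong n (λ S → cong₂ _⊕_ (f≡g (false ∷ S)) (f≡g (true ∷ S)))

⊕-interchange : ∀ a b c d → (a ⊕ b) ⊕ (c ⊕ d) ≡ (a ⊕ c) ⊕ (b ⊕ d)
⊕-interchange = solve-∀ dual-ring

∑ˢ-⊕ : ∀ n (f g : Vec Bool n → Dual) → ∑ˢ n (λ S → f S ⊕ g S) ≡ ∑ˢ n f ⊕ ∑ˢ n g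
∑ˢ-⊕ zero    f g = refl
∑ˢ-⊕ (suc n) f g = trans
  (∑ˢ-cong n (λ S → ⊕-interchange (f (false ∷ S)) (g (false ∷ S)) (f (true ∷ S)) (g (true ∷ S))))
  (∑ˢ-⊕ n _ _)

∑ˢ-⊛ : ∀ n c (f : Vec Bool n → Dual) → ∑ˢ n (λ S → c ⊛ f S) ≡ c ⊛ ∑ˢ n f
∑ˢ-⊛ zero    c f = refl
∑ˢ-⊛ (suc n) c f = trans
  (∑ˢ-cong n (λ S → ≡.sym (⊛-distribˡ-⊕ c (f (false ∷ S)) (f (true ∷ S)))))
  (∑ˢ-⊛ n c _)

∑ˢ-split : ∀ {n} (i : Fin (suc n)) (f : Vec Bool (suc n) → Dual) →
           ∑ˢ (suc n) f ≡ ∑ˢ n (λ S → f (insertAt S i false) ⊕ f (insertAt S i true))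
∑ˢ-split         zero    f = refl
∑ˢ-split {suc n} (suc i) f = trans (∑ˢ-split i (λ S → f (false ∷ S) ⊕ f (true ∷ S)))
  (∑ˢ-cong n (λ S → ⊕-interchange (f (false ∷ insertAt S i false)) (f (true ∷ insertAt S i false))
                                  (f (false ∷ insertAt S i true)) (f (true ∷ insertAt S i true))))

-- Putting 1 at `x` omits its factor but keeps the index set `Fin n`, so the same graph and the same
-- subsets serve with `x` left out.
skip : ∀ {n} → Fin n → (Fin n → Dual) → Fin n → Dual
skip x f v = if does (v ≟ x) then 1ᴰ else f v

∏-extract : ∀ {n} (x : Fin n) (f : Fin n → Dual) → Π.sum f ≡ f x ⊛ Π.sum (skip x f)
∏-extract zero    f = cong (f zero ⊛_) (≡.sym (⊛-identityˡ _))
∏-extract (suc x) f = trans (cong (f zero ⊛_) (∏-extract x (f ∘ suc))) (lemma (f zero) (f (suc x)) _)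
  where
  lemma : ∀ a b c → a ⊛ (b ⊛ c) ≡ b ⊛ (a ⊛ c)
  lemma = solve-∀ dual-ring

skip-cong : ∀ {n} (x : Fin n) {f g : Fin n → Dual} → (∀ v → v ≢ x → f v ≡ g v) → ∀ v → skip x f v ≡ skip x g v
skip-cong x f≡g v with v ≟ x
... | yes _   = refl
... | no v≢x = f≡g v v≢x

record Weight : Set where
  constructor ⟨_,_,_⟩
  field
    inside dominated pending : Dual
open Weight

-- The flags tell whether the vertex is in S and whether S contains one of its remaining neighbours.
-- The pending weight collects pruned configurations that leave the vertex undominated, so it counts
-- only if the vertex is hit.
local : Weight → Bool → Bool → Dual
local w true  _     = inside w
local w false true  = dominated w ⊕ pending w
local w false false = dominated w

-- The weight at x of a tree rooted at x after a tree with root weight w′ is attached to x by an edge.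
_◂_ : Weight → Weight → Weight
⟨ p , q , u ⟩ ◂ ⟨ p′ , q′ , u′ ⟩ = ⟨ p ⊛ (p′ ⊕ q′ ⊕ u′) , q ⊛ (p′ ⊕ q′) ⊕ u ⊛ p′ , u ⊛ q′ ⟩

-- Here `b` tells whether the root is in S and `d` whether another neighbour hits it. The summands
-- are the cases of the pruned vertex outside and inside S: it is hit exactly if `b`, and in the
-- second case it hits the root.
local-◂ : ∀ w w′ b d → local w′ false b ⊛ local w b d ⊕ local w′ true b ⊛ local w b true ≡ local (w ◂ w′) b d
local-◂ ⟨ p , q , u ⟩ ⟨ p′ , q′ , u′ ⟩ true  d     = lemma p p′ q′ u′
  where
  lemma : ∀ p p′ q′ u′ → (q′ ⊕ u′) ⊛ p ⊕ p′ ⊛ p ≡ p ⊛ (p′ ⊕ q′ ⊕ u′)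
  lemma = solve-∀ dual-ring
local-◂ ⟨ p , q , u ⟩ ⟨ p′ , q′ , u′ ⟩ false true  = lemma q u p′ q′
  where
  lemma : ∀ q u p′ q′ → q′ ⊛ (q ⊕ u) ⊕ p′ ⊛ (q ⊕ u) ≡ q ⊛ (p′ ⊕ q′) ⊕ u ⊛ p′ ⊕ u ⊛ q′
  lemma = solve-∀ dual-ring
local-◂ ⟨ p , q , u ⟩ ⟨ p′ , q′ , u′ ⟩ false false = lemma q u p′ q′
  where
  lemma : ∀ q u p′ q′ → q′ ⊛ q ⊕ p′ ⊛ (q ⊕ u) ≡ q ⊛ (p′ ⊕ q′) ⊕ u ⊛ p′
  lemma = solve-∀ dual-ring

hit : ∀ {n} → Graph n → Vec Bool n → Fin n → Bool
hit G S v = ⋁.sum (λ u → lookup S u ∧ adj G u v)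

factor : ∀ {n} → Graph n → (Fin n → Weight) → Vec Bool n → Fin n → Dual
factor G w S v = local (w v) (lookup S v) (hit G S v)

Z : ∀ {n} → Graph n → (Fin n → Weight) → Dual
Z {n} G w = ∑ˢ n (λ S → Π.sum (factor G w S))

rest : ∀ {n} → Graph n → (Fin n → Weight) → Fin n → Vec Bool n → Dual
rest G w x S = Π.sum (skip x (factor G w S))

⟦_⟧ : Bool → Dual
⟦ true ⟧  = 1ᴰ
⟦ false ⟧ = 0ᴰ

-- These are the coefficients of the three components of the weight at `x`. The dominated weight is
-- collected from every S avoiding `x`, the pending weight only from those that also hit `x`.
inSum outSum hitSum : ∀ {n} → Graph n → (Fin n → Weight) → Fin n → Dual
inSum  {n} G w x = ∑ˢ n (λ S → ⟦ lookup S x ⟧ ⊛ rest G w x S)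
outSum {n} G w x = ∑ˢ n (λ S → ⟦ not (lookup S x) ⟧ ⊛ rest G w x S)
hitSum {n} G w x = ∑ˢ n (λ S → ⟦ not (lookup S x) ∧ hit G S x ⟧ ⊛ rest G w x S)

-- Z as a linear functional of the weight at x; the value w x is ignored.
Zat : ∀ {n} → Graph n → (Fin n → Weight) → Fin n → Weight → Dual
Zat G w x t = inside t ⊛ inSum G w x ⊕ dominated t ⊛ outSum G w x ⊕ pending t ⊛ hitSum G w x

∑ˢ-local : ∀ {n} (G : Graph n) w x t →
           ∑ˢ n (λ S → local t (lookup S x) (hit G S x) ⊛ rest G w x S) ≡ Zat G w x t
∑ˢ-local {n} G w x t@(⟨ p , q , u ⟩) = begin
  ∑ˢ n (λ S → local t (lookup S x) (hit G S x) ⊛ rest G w x S)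
    ≡⟨ ∑ˢ-cong n (λ S → expand (lookup S x) (hit G S x) (rest G w x S)) ⟩
  ∑ˢ n (λ S → p ⊛ A S ⊕ q ⊛ B S ⊕ u ⊛ C S)
    ≡⟨ trans (∑ˢ-⊕ n _ _) (cong (_⊕ ∑ˢ n (λ S → u ⊛ C S)) (∑ˢ-⊕ n _ _)) ⟩
  ∑ˢ n (λ S → p ⊛ A S) ⊕ ∑ˢ n (λ S → q ⊛ B S) ⊕ ∑ˢ n (λ S → u ⊛ C S)
    ≡⟨ cong₂ _⊕_ (cong₂ _⊕_ (∑ˢ-⊛ n p A) (∑ˢ-⊛ n q B)) (∑ˢ-⊛ n u C) ⟩
  Zat G w x t ∎
  where
  open ≡-Reasoning
  A B C : Vec Bool n → Dual
  A S = ⟦ lookup S x ⟧ ⊛ rest G w x S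
  B S = ⟦ not (lookup S x) ⟧ ⊛ rest G w x S
  C S = ⟦ not (lookup S x) ∧ hit G S x ⟧ ⊛ rest G w x S
  l₁ : ∀ p q u r → p ⊛ r ≡ p ⊛ (1ᴰ ⊛ r) ⊕ q ⊛ (0ᴰ ⊛ r) ⊕ u ⊛ (0ᴰ ⊛ r)
  l₁ = solve-∀ dual-ring
  l₂ : ∀ p q u r → (q ⊕ u) ⊛ r ≡ p ⊛ (0ᴰ ⊛ r) ⊕ q ⊛ (1ᴰ ⊛ r) ⊕ u ⊛ (1ᴰ ⊛ r)
  l₂ = solve-∀ dual-ring
  l₃ : ∀ p q u r → q ⊛ r ≡ p ⊛ (0ᴰ ⊛ r) ⊕ q ⊛ (1ᴰ ⊛ r) ⊕ u ⊛ (0ᴰ ⊛ r)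
  l₃ = solve-∀ dual-ring
  expand : ∀ b d r → local t b d ⊛ r ≡ p ⊛ (⟦ b ⟧ ⊛ r) ⊕ q ⊛ (⟦ not b ⟧ ⊛ r) ⊕ u ⊛ (⟦ not b ∧ d ⟧ ⊛ r)
  expand true  d     r = l₁ p q u r
  expand false true  r = l₂ p q u r
  expand false false r = l₃ p q u r

-- The coefficients see the weights of the other vertices only, so changing the weight at `x` means
-- evaluating the same functional at another point.
Z-at : ∀ {n} (G : Graph n) {w w′ : Fin n → Weight} x → (∀ v → v ≢ x → w′ v ≡ w v) → Z G w′ ≡ Zat G w x (w′ x)
Z-at {n} G {w} {w′} x agree = trans
  (∑ˢ-cong n (λ S → trans (∏-extract x (factor G w′ S))
    (cong (local (w′ x) (lookup S x) (hit G S x) ⊛_)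
      (Π.sum-cong-≗ (skip-cong x (λ v v≢x → cong (λ t → local t (lookup S v) (hit G S v)) (agree v v≢x)))))))
  (∑ˢ-local G w x (w′ x))

-- Deleting an isolated vertex or a leaf

delete : ∀ {n} → Graph (suc n) → Fin (suc n) → Graph n
delete G ℓ = record
  { adj    = λ u v → adj G (punchIn ℓ u) (punchIn ℓ v)
  ; sym    = λ u v → Graph.sym G (punchIn ℓ u) (punchIn ℓ v)
  ; irrefl = λ v → irrefl G (punchIn ℓ v) }

-- Without loops no vertex hits itself, so the bit `b` drops out.
hit-insert-self : ∀ {n} (G : Graph (suc n)) ℓ S b →
                  hit G (insertAt S ℓ b) ℓ ≡ ⋁.sum (λ y → lookup S y ∧ adj G ℓ (punchIn ℓ y))
hit-insert-self G ℓ S b = trans (⋁.sum-remove {i = ℓ} (λ u → lookup (insertAt S ℓ b) u ∧ adj G u ℓ)) (cong₂ _∨_ here (⋁.sum-cong-≗ there))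
  where
  here : lookup (insertAt S ℓ b) ℓ ∧ adj G ℓ ℓ ≡ false
  here rewrite irrefl G ℓ = ∧-zeroʳ _
  there : ∀ y → lookup (insertAt S ℓ b) (punchIn ℓ y) ∧ adj G (punchIn ℓ y) ℓ ≡ lookup S y ∧ adj G ℓ (punchIn ℓ y)
  there y = cong₂ _∧_ (insertAt-punchIn S ℓ b y) (Graph.sym G _ _)

hit-insert : ∀ {n} (G : Graph (suc n)) ℓ S b v →
             hit G (insertAt S ℓ b) (punchIn ℓ v) ≡ (b ∧ adj G ℓ (punchIn ℓ v)) ∨ hit (delete G ℓ) S v
hit-insert G ℓ S b v = trans (⋁.sum-remove {i = ℓ} (λ u → lookup (insertAt S ℓ b) u ∧ adj G u (punchIn ℓ v)))
  (cong₂ _∨_ (cong (_∧ _) (insertAt-lookup S ℓ b)) (⋁.sum-cong-≗ (λ y → cong (_∧ _) (insertAt-punchIn S ℓ b y))))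

∏-insert : ∀ {n} (G : Graph (suc n)) w ℓ S b →
           Π.sum (factor G w (insertAt S ℓ b))
             ≡ local (w ℓ) b (⋁.sum (λ y → lookup S y ∧ adj G ℓ (punchIn ℓ y)))
             ⊛ Π.sum (λ v → local (w (punchIn ℓ v)) (lookup S v) ((b ∧ adj G ℓ (punchIn ℓ v)) ∨ hit (delete G ℓ) S v))
∏-insert G w ℓ S b = trans (Π.sum-remove {i = ℓ} (factor G w (insertAt S ℓ b)))
  (cong₂ _⊛_ (cong₂ (local (w ℓ)) (insertAt-lookup S ℓ b) (hit-insert-self G ℓ S b))
             (Π.sum-cong-≗ (λ v → cong₂ (local (w (punchIn ℓ v))) (insertAt-punchIn S ℓ b v) (hit-insert G ℓ S b v))))

⋁-false : ∀ {n} (f : Fin n → Bool) → (∀ y → f y ≡ false) → ⋁.sum f ≡ false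
⋁-false {n} f f≡false = trans (⋁.sum-cong-≗ f≡false) (⋁.sum-replicate-zero n)

⋁-single : ∀ {n} (f : Fin n → Bool) x → (∀ y → y ≢ x → f y ≡ false) → ⋁.sum f ≡ f x
⋁-single {suc n} f x only = trans (⋁.sum-remove {i = x} f)
  (trans (cong (f x ∨_) (⋁-false _ (λ y → only _ (punchInᵢ≢i x y)))) (∨-identityʳ (f x)))

-- No neighbour can hit `ℓ`, so its pending weight never contributes, and its factor is the same for
-- every choice on the other vertices.
Z-isolated : ∀ {n} (G : Graph (suc n)) w ℓ → (∀ y → adj G ℓ (punchIn ℓ y) ≡ false) →
             Z G w ≡ (inside (w ℓ) ⊕ dominated (w ℓ)) ⊛ Z (delete G ℓ) (w ∘ punchIn ℓ)
Z-isolated {n} G w ℓ iso = begin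
  Z G w
    ≡⟨ ∑ˢ-split ℓ (λ S → Π.sum (factor G w S)) ⟩
  ∑ˢ n (λ S → Π.sum (factor G w (insertAt S ℓ false)) ⊕ Π.sum (factor G w (insertAt S ℓ true)))
    ≡⟨ ∑ˢ-cong n (λ S → trans (cong₂ _⊕_ (side S false) (side S true)) (lemma (inside (w ℓ)) (dominated (w ℓ)) _)) ⟩
  ∑ˢ n (λ S → (inside (w ℓ) ⊕ dominated (w ℓ)) ⊛ Π.sum (factor (delete G ℓ) (w ∘ punchIn ℓ) S))
    ≡⟨ ∑ˢ-⊛ n _ _ ⟩
  (inside (w ℓ) ⊕ dominated (w ℓ)) ⊛ Z (delete G ℓ) (w ∘ punchIn ℓ) ∎
  where
  open ≡-Reasoning
  lemma : ∀ p q r → q ⊛ r ⊕ p ⊛ r ≡ (p ⊕ q) ⊛ r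
  lemma = solve-∀ dual-ring
  side : ∀ S b → Π.sum (factor G w (insertAt S ℓ b)) ≡ local (w ℓ) b false ⊛ Π.sum (factor (delete G ℓ) (w ∘ punchIn ℓ) S)
  side S b = trans (∏-insert G w ℓ S b)
    (cong₂ _⊛_ (cong (local (w ℓ) b) (⋁-false _ (λ y → trans (cong (lookup S y ∧_) (iso y)) (∧-zeroʳ _))))
               (Π.sum-cong-≗ (λ v → cong (local (w (punchIn ℓ v)) (lookup S v))
                                         (cong (_∨ hit (delete G ℓ) S v) (trans (cong (b ∧_) (iso v)) (∧-zeroʳ b))))))

-- Once the membership of `x` is fixed, `ℓ` interacts with nothing else. Summing over the membership
-- of `ℓ` therefore changes only the factor at `x`, and `local-◂` identifies the new factor.
Z-leaf : ∀ {n} (G : Graph (suc n)) w ℓ x → adj G ℓ (punchIn ℓ x) ≡ true →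
         (∀ y → y ≢ x → adj G ℓ (punchIn ℓ y) ≡ false) →
         Z G w ≡ Zat (delete G ℓ) (w ∘ punchIn ℓ) x (w (punchIn ℓ x) ◂ w ℓ)
Z-leaf {n} G w ℓ x ℓx only = begin
  Z G w
    ≡⟨ ∑ˢ-split ℓ (λ S → Π.sum (factor G w S)) ⟩
  ∑ˢ n (λ S → Π.sum (factor G w (insertAt S ℓ false)) ⊕ Π.sum (factor G w (insertAt S ℓ true)))
    ≡⟨ ∑ˢ-cong n (λ S → trans (cong₂ _⊕_ (side S false) (side S true)) (combine (lookup S x) (hit G′ S x) (rest G′ w′ x S))) ⟩
  ∑ˢ n (λ S → local (w (punchIn ℓ x) ◂ w ℓ) (lookup S x) (hit G′ S x) ⊛ rest G′ w′ x S)
    ≡⟨ ∑ˢ-local G′ w′ x _ ⟩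
  Zat G′ w′ x (w (punchIn ℓ x) ◂ w ℓ) ∎
  where
  open ≡-Reasoning
  G′ = delete G ℓ
  w′ = w ∘ punchIn ℓ
  lemma : ∀ a b c d r → a ⊛ (b ⊛ r) ⊕ c ⊛ (d ⊛ r) ≡ (a ⊛ b ⊕ c ⊛ d) ⊛ r
  lemma = solve-∀ dual-ring
  combine : ∀ b d r → local (w ℓ) false b ⊛ (local (w′ x) b d ⊛ r) ⊕ local (w ℓ) true b ⊛ (local (w′ x) b true ⊛ r)
                    ≡ local (w′ x ◂ w ℓ) b d ⊛ r
  combine b d r = trans (lemma (local (w ℓ) false b) (local (w′ x) b d) (local (w ℓ) true b) (local (w′ x) b true) r)
                        (cong (_⊛ r) (local-◂ (w′ x) (w ℓ) b d))
  side : ∀ S b → Π.sum (factor G w (insertAt S ℓ b))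
               ≡ local (w ℓ) b (lookup S x) ⊛ (local (w′ x) (lookup S x) (b ∨ hit G′ S x) ⊛ rest G′ w′ x S)
  side S b = trans (∏-insert G w ℓ S b) (cong₂ _⊛_
    (cong (local (w ℓ) b)
      (trans (⋁-single _ x (λ y y≢x → trans (cong (lookup S y ∧_) (only y y≢x)) (∧-zeroʳ _)))
             (trans (cong (lookup S x ∧_) ℓx) (∧-identityʳ _))))
    (trans (∏-extract x _) (cong₂ _⊛_
      (cong (λ a → local (w′ x) (lookup S x) (a ∨ hit G′ S x)) (trans (cong (b ∧_) ℓx) (∧-identityʳ b)))
      (Π.sum-cong-≗ (skip-cong x (λ v v≢x →
        cong (λ a → local (w′ v) (lookup S v) (a ∨ hit G′ S v)) (trans (cong (b ∧_) (only v v≢x)) (∧-zeroʳ b))))))))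

-- Monotonicity of the counts

+-nonneg : ∀ {a b} → 0ℤ ℤ.≤ a → 0ℤ ℤ.≤ b → 0ℤ ℤ.≤ a ℤ.+ b
+-nonneg 0≤a 0≤b = ℤₚ.+-mono-≤ 0≤a 0≤b

*-nonneg : ∀ {a b} → 0ℤ ℤ.≤ a → 0ℤ ℤ.≤ b → 0ℤ ℤ.≤ a ℤ.* b
*-nonneg {+ m} {+ n} _ _ = subst (0ℤ ℤ.≤_) (ℤₚ.pos-* m n) (ℤ.+≤+ z≤n)

*-pos : ∀ {a b} → 0ℤ ℤ.< a → 0ℤ ℤ.< b → 0ℤ ℤ.< a ℤ.* b
*-pos {ℤ.+[1+ m ]} {ℤ.+[1+ n ]} _ _ = ℤ.+<+ (s≤s z≤n)
*-pos {ℤ.+0} (ℤ.+<+ ()) _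
*-pos {ℤ.+[1+ m ]} {ℤ.+0} _ (ℤ.+<+ ())

*-mono-nonneg : ∀ {a b c d} → 0ℤ ℤ.≤ a → a ℤ.≤ b → 0ℤ ℤ.≤ c → c ℤ.≤ d → a ℤ.* c ℤ.≤ b ℤ.* d
*-mono-nonneg {a} {b} {c} {d} 0≤a a≤b 0≤c c≤d = ℤₚ.≤-trans
  (ℤₚ.*-monoˡ-≤-nonNeg a {{ℤ.nonNegative 0≤a}} c≤d)
  (ℤₚ.*-monoʳ-≤-nonNeg d {{ℤ.nonNegative (ℤₚ.≤-trans 0≤c c≤d)}} a≤b)

re-⊕ : ∀ x y → re (x ⊕ y) ≡ re x ℤ.+ re y
re-⊕ (_ +ε _) (_ +ε _) = refl

re-⊛ : ∀ x y → re (x ⊛ y) ≡ re x ℤ.* re y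
re-⊛ (_ +ε _) (_ +ε _) = refl

infix 4 _≤ʳ_
-- Only the real parts, which are the counts, are compared; nothing is said about the ε-parts.
record _≤ʳ_ (x y : Dual) : Set where
  constructor ↑_
  field ↓_ : re x ℤ.≤ re y
open _≤ʳ_

record Positive (x : Dual) : Set where
  constructor ↑_
  field ↓_ : 0ℤ ℤ.< re x
open Positive

≤ʳ-refl : ∀ {x} → x ≤ʳ x
≤ʳ-refl = ↑ ℤₚ.≤-refl

≤ʳ-trans : ∀ {x y z} → x ≤ʳ y → y ≤ʳ z → x ≤ʳ z
≤ʳ-trans (↑ p) (↑ q) = ↑ ℤₚ.≤-trans p q

1ᴰ-nonneg : 0ᴰ ≤ʳ 1ᴰ
1ᴰ-nonneg = ↑ ℤ.+≤+ z≤n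

1ᴰ-pos : Positive 1ᴰ
1ᴰ-pos = ↑ ℤ.+<+ (s≤s z≤n)

⊕-mono-≤ʳ : ∀ {x x′ y y′} → x ≤ʳ x′ → y ≤ʳ y′ → x ⊕ y ≤ʳ x′ ⊕ y′
⊕-mono-≤ʳ {x} {x′} {y} {y′} (↑ p) (↑ q) =
  ↑ subst₂ ℤ._≤_ (≡.sym (re-⊕ x y)) (≡.sym (re-⊕ x′ y′)) (ℤₚ.+-mono-≤ p q)

⊛-mono-≤ʳ : ∀ {x x′ y y′} → 0ᴰ ≤ʳ x → x ≤ʳ x′ → 0ᴰ ≤ʳ y → y ≤ʳ y′ → x ⊛ y ≤ʳ x′ ⊛ y′
⊛-mono-≤ʳ {x} {x′} {y} {y′} (↑ 0≤x) (↑ p) (↑ 0≤y) (↑ q) =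
  ↑ subst₂ ℤ._≤_ (≡.sym (re-⊛ x y)) (≡.sym (re-⊛ x′ y′)) (*-mono-nonneg 0≤x p 0≤y q)

⊕-nonneg : ∀ {x y} → 0ᴰ ≤ʳ x → 0ᴰ ≤ʳ y → 0ᴰ ≤ʳ x ⊕ y
⊕-nonneg {x} {y} (↑ 0≤x) (↑ 0≤y) = ↑ subst (0ℤ ℤ.≤_) (≡.sym (re-⊕ x y)) (+-nonneg 0≤x 0≤y)

⊛-nonneg : ∀ {x y} → 0ᴰ ≤ʳ x → 0ᴰ ≤ʳ y → 0ᴰ ≤ʳ x ⊛ y
⊛-nonneg {x} {y} (↑ 0≤x) (↑ 0≤y) = ↑ subst (0ℤ ℤ.≤_) (≡.sym (re-⊛ x y)) (*-nonneg 0≤x 0≤y)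

⊕-pos : ∀ {x y} → 0ᴰ ≤ʳ x → Positive y → Positive (x ⊕ y)
⊕-pos {x} {y} (↑ 0≤x) (↑ 0<y) = ↑ subst (0ℤ ℤ.<_) (≡.sym (re-⊕ x y)) (ℤₚ.+-mono-≤-< 0≤x 0<y)

⊛-pos : ∀ {x y} → Positive x → Positive y → Positive (x ⊛ y)
⊛-pos {x} {y} (↑ 0<x) (↑ 0<y) = ↑ subst (0ℤ ℤ.<_) (≡.sym (re-⊛ x y)) (*-pos 0<x 0<y)

∏-nonneg : ∀ {n} {f : Fin n → Dual} → (∀ v → 0ᴰ ≤ʳ f v) → 0ᴰ ≤ʳ Π.sum f
∏-nonneg {zero}  0≤f = 1ᴰ-nonneg
∏-nonneg {suc n} 0≤f = ⊛-nonneg (0≤f zero) (∏-nonneg (0≤f ∘ suc))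

∏-mono : ∀ {n} {f g : Fin n → Dual} → (∀ v → 0ᴰ ≤ʳ f v) → (∀ v → f v ≤ʳ g v) → Π.sum f ≤ʳ Π.sum g
∏-mono {zero}  0≤f f≤g = ≤ʳ-refl
∏-mono {suc n} 0≤f f≤g = ⊛-mono-≤ʳ (0≤f zero) (f≤g zero) (∏-nonneg (0≤f ∘ suc)) (∏-mono (0≤f ∘ suc) (f≤g ∘ suc))

∏-pos : ∀ {n} {f : Fin n → Dual} → (∀ v → Positive (f v)) → Positive (Π.sum f)
∏-pos {zero}  0<f = 1ᴰ-pos
∏-pos {suc n} 0<f = ⊛-pos (0<f zero) (∏-pos (0<f ∘ suc))

∑ˢ-mono : ∀ n {f g : Vec Bool n → Dual} → (∀ S → f S ≤ʳ g S) → ∑ˢ n f ≤ʳ ∑ˢ n g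
∑ˢ-mono zero    f≤g = f≤g []
∑ˢ-mono (suc n) f≤g = ∑ˢ-mono n (λ S → ⊕-mono-≤ʳ (f≤g (false ∷ S)) (f≤g (true ∷ S)))

∑ˢ-nonneg : ∀ n {f : Vec Bool n → Dual} → (∀ S → 0ᴰ ≤ʳ f S) → 0ᴰ ≤ʳ ∑ˢ n f
∑ˢ-nonneg zero    0≤f = 0≤f []
∑ˢ-nonneg (suc n) 0≤f = ∑ˢ-nonneg n (λ S → ⊕-nonneg (0≤f (false ∷ S)) (0≤f (true ∷ S)))

-- One positive term among nonnegative ones suffices. The full vertex set is singled out because it
-- always dominates.
∑ˢ-pos : ∀ n {f : Vec Bool n → Dual} → (∀ S → 0ᴰ ≤ʳ f S) → Positive (f (replicate n true)) → Positive (∑ˢ n f)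
∑ˢ-pos zero    0≤f 0<f = 0<f
∑ˢ-pos (suc n) 0≤f 0<f = ∑ˢ-pos n (λ S → ⊕-nonneg (0≤f (false ∷ S)) (0≤f (true ∷ S))) (⊕-pos (0≤f _) 0<f)

⟦⟧-nonneg : ∀ b → 0ᴰ ≤ʳ ⟦ b ⟧
⟦⟧-nonneg true  = 1ᴰ-nonneg
⟦⟧-nonneg false = ≤ʳ-refl

-- Adding `x` maps the subsets avoiding `x` bijectively to those containing it, and by `mono` no
-- term decreases.
∑ˢ-insert-≤ : ∀ {n} (x : Fin n) {g : Vec Bool n → Dual} → (∀ S → g S ≤ʳ g (S [ x ]≔ true)) →
              ∑ˢ n (λ S → ⟦ not (lookup S x) ⟧ ⊛ g S) ≤ʳ ∑ˢ n (λ S → ⟦ lookup S x ⟧ ⊛ g S)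
∑ˢ-insert-≤ {suc n} zero {g} mono = ∑ˢ-mono n (λ S →
  subst₂ _≤ʳ_ (≡.sym (l₁ (g (false ∷ S)) (g (true ∷ S)))) (≡.sym (l₂ (g (false ∷ S)) (g (true ∷ S)))) (mono (false ∷ S)))
  where
  l₁ : ∀ a b → 1ᴰ ⊛ a ⊕ 0ᴰ ⊛ b ≡ a
  l₁ = solve-∀ dual-ring
  l₂ : ∀ a b → 0ᴰ ⊛ a ⊕ 1ᴰ ⊛ b ≡ b
  l₂ = solve-∀ dual-ring
∑ˢ-insert-≤ {suc n} (suc x) {g} mono = subst₂ _≤ʳ_
  (∑ˢ-cong n (λ S → ⊛-distribˡ-⊕ ⟦ not (lookup S x) ⟧ (g (false ∷ S)) (g (true ∷ S))))
  (∑ˢ-cong n (λ S → ⊛-distribˡ-⊕ ⟦ lookup S x ⟧ (g (false ∷ S)) (g (true ∷ S))))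
  (∑ˢ-insert-≤ x (λ S → ⊕-mono-≤ʳ (mono (false ∷ S)) (mono (true ∷ S))))

-- Besides signs, this records that the pruned part allows at least as many configurations with the
-- vertex in S as without it. That bounds the coefficients when a hub is pruned.
record Admissible (w : Weight) : Set where
  field
    dominated-nonneg : 0ᴰ ≤ʳ dominated w
    pending-nonneg   : 0ᴰ ≤ʳ pending w
    inside-pos       : Positive (inside w)
    outside≤inside   : dominated w ⊕ pending w ≤ʳ inside w

  inside-nonneg : 0ᴰ ≤ʳ inside w
  inside-nonneg = ↑ ℤₚ.<⇒≤ (↓ inside-pos)
open Admissible

local-nonneg : ∀ {w} → Admissible w → ∀ b d → 0ᴰ ≤ʳ local w b d
local-nonneg a true  d     = inside-nonneg a
local-nonneg a false true  = ⊕-nonneg (dominated-nonneg a) (pending-nonneg a)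
local-nonneg a false false = dominated-nonneg a

≤ʳ-⊕ : ∀ {x y} → 0ᴰ ≤ʳ y → x ≤ʳ x ⊕ y
≤ʳ-⊕ {x} {y} (↑ 0≤y) = ↑ subst₂ ℤ._≤_ (ℤₚ.+-identityʳ _) (≡.sym (re-⊕ x y)) (ℤₚ.+-monoʳ-≤ (re x) 0≤y)

-- The equation `d ∨ d′ ≡ d′` is the order on Booleans; a hit can only admit the pending
-- configurations in addition.
local-mono : ∀ {w} → Admissible w → ∀ b {d d′} → d ∨ d′ ≡ d′ → local w b d ≤ʳ local w b d′
local-mono a true  _ = ≤ʳ-refl
local-mono a false {true}  {true}  _ = ≤ʳ-refl
local-mono a false {false} {false} _ = ≤ʳ-refl
local-mono a false {false} {true}  _ = ≤ʳ-⊕ (pending-nonneg a)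

⋁-mono : ∀ {n} (f g : Fin n → Bool) → (∀ v → f v ∨ g v ≡ g v) → ⋁.sum f ∨ ⋁.sum g ≡ ⋁.sum g
⋁-mono f g f≤g = trans (≡.sym (⋁.∑-distrib-+ f g)) (⋁.sum-cong-≗ f≤g)

hit-insert-mono : ∀ {n} (G : Graph n) S x v → hit G S v ∨ hit G (S [ x ]≔ true) v ≡ hit G (S [ x ]≔ true) v
hit-insert-mono G S x v = ⋁-mono _ _ (λ u → lemma (lookup S u) (lookup (S [ x ]≔ true) u) (adj G u v) (update-mono S x u))
  where
  update-mono : ∀ {n} (S : Vec Bool n) x u → lookup S u ∨ lookup (S [ x ]≔ true) u ≡ lookup (S [ x ]≔ true) u
  update-mono (b ∷ S) zero    zero    = ∨-zeroʳ b
  update-mono (b ∷ S) zero    (suc u) = ∨-idem _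
  update-mono (b ∷ S) (suc x) zero    = ∨-idem b
  update-mono (b ∷ S) (suc x) (suc u) = update-mono S x u
  lemma : ∀ a b c → a ∨ b ≡ b → (a ∧ c) ∨ (b ∧ c) ≡ b ∧ c
  lemma a b c a∨b≡b = trans (≡.sym (∧-distribʳ-∨ c a b)) (cong (_∧ c) a∨b≡b)

module _ {n} (x : Fin n) {f : Fin n → Dual} where

  skip-nonneg : (∀ v → 0ᴰ ≤ʳ f v) → ∀ v → 0ᴰ ≤ʳ skip x f v
  skip-nonneg 0≤f v with v ≟ x
  ... | yes _ = 1ᴰ-nonneg
  ... | no  _ = 0≤f v

  skip-pos : (∀ v → Positive (f v)) → ∀ v → Positive (skip x f v)
  skip-pos 0<f v with v ≟ x
  ... | yes _ = 1ᴰ-pos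
  ... | no  _ = 0<f v

  skip-mono : ∀ {g} → (∀ v → v ≢ x → f v ≤ʳ g v) → ∀ v → skip x f v ≤ʳ skip x g v
  skip-mono f≤g v with v ≟ x
  ... | yes _   = ≤ʳ-refl
  ... | no v≢x = f≤g v v≢x

module _ {n} (G : Graph n) {w : Fin n → Weight} (adm : ∀ v → Admissible (w v)) where

  factor-nonneg : ∀ S v → 0ᴰ ≤ʳ factor G w S v
  factor-nonneg S v = local-nonneg (adm v) (lookup S v) (hit G S v)

  factor-pos : ∀ v → Positive (factor G w (replicate n true) v)
  factor-pos v rewrite lookup-replicate v true = inside-pos (adm v)

  -- The vertex `x` is excluded because its own factor may switch from outside to inside; elsewhere
  -- only hits are gained.
  factor-mono : ∀ x S v → v ≢ x → factor G w S v ≤ʳ factor G w (S [ x ]≔ true) v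
  factor-mono x S v v≢x rewrite lookup∘update′ v≢x S true = local-mono (adm v) (lookup S v) (hit-insert-mono G S x v)

  Z-pos : Positive (Z G w)
  Z-pos = ∑ˢ-pos n (λ S → ∏-nonneg (factor-nonneg S)) (∏-pos factor-pos)

  module _ (x : Fin n) where

    rest-nonneg : ∀ S → 0ᴰ ≤ʳ rest G w x S
    rest-nonneg S = ∏-nonneg (skip-nonneg x (factor-nonneg S))

    inSum-pos : Positive (inSum G w x)
    inSum-pos = ∑ˢ-pos n (λ S → ⊛-nonneg (⟦⟧-nonneg (lookup S x)) (rest-nonneg S)) top
      where
      top : Positive (⟦ lookup (replicate n true) x ⟧ ⊛ rest G w x (replicate n true))
      top rewrite lookup-replicate x true = ⊛-pos 1ᴰ-pos (∏-pos (skip-pos x factor-pos))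

    outSum≤inSum : outSum G w x ≤ʳ inSum G w x
    outSum≤inSum = ∑ˢ-insert-≤ x (λ S → ∏-mono (skip-nonneg x (factor-nonneg S)) (skip-mono x (factor-mono x S)))

    outSum-nonneg : 0ᴰ ≤ʳ outSum G w x
    outSum-nonneg = ∑ˢ-nonneg n (λ S → ⊛-nonneg (⟦⟧-nonneg (not (lookup S x))) (rest-nonneg S))

    hitSum-nonneg : 0ᴰ ≤ʳ hitSum G w x
    hitSum-nonneg = ∑ˢ-nonneg n (λ S → ⊛-nonneg (⟦⟧-nonneg (not (lookup S x) ∧ hit G S x)) (rest-nonneg S))

-- Kinds of vertices and their weights

-- M and E are the count and the excess ∑ (3|S| - 2n) of the dominating sets of the stars at the hub,
-- e is the excess of the only one that avoids all their centres.
record Hub : Set where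
  field
    M E e : ℤ
    3≤M   : + 3 ℤ.≤ M
    E≤0   : E ℤ.≤ 0ℤ
    slack : 0ℤ ℤ.≤ M ℤ.- 1ℤ ℤ.+ + 2 ℤ.* e
open Hub

0≤M-1 : ∀ h → 0ℤ ℤ.≤ M h ℤ.- 1ℤ
0≤M-1 h = ℤₚ.i≤j⇒0≤j-i (ℤₚ.≤-trans (ℤ.+≤+ (s≤s z≤n)) (3≤M h))

data Kind : Set where
  fresh   : Kind
  support : ℕ → Kind
  hub     : Hub → Kind

two^ : ℕ → ℤ
two^ j = + (2 ^ j)

-- Each entry expands a product over the pruned vertices and the root. For `support j` with the root
-- in S every leaf is free, giving (1 + ε)(2 - ε)^(j+1); with the root outside every leaf is forced,
-- giving (1 - 2ε)(1 + ε)^(j+1), and the root is dominated. For a hub, the stars contribute M + Eε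
-- in total, of which 1 + eε leaves the hub undominated.
weight : Kind → Weight
weight fresh       = ⟨ 1ℤ +ε 1ℤ , 0ᴰ , 1ℤ +ε ℤ.- + 2 ⟩
weight (support j) = ⟨ + 2 ℤ.* two^ j +ε two^ j ℤ.* (1ℤ ℤ.- + j) , 1ℤ +ε + j ℤ.- 1ℤ , 0ᴰ ⟩
weight (hub h)     = ⟨ M h +ε E h ℤ.+ M h
                     , M h ℤ.- 1ℤ +ε E h ℤ.- + 2 ℤ.* M h ℤ.- e h ℤ.+ + 2
                     , 1ℤ +ε e h ℤ.- + 2 ⟩

-- For a star with j + 1 leaves this is the sum of 2^j (1 - j), from the sets with the centre, and j
-- - 1, from the only set without it.
starExcess : ℕ → ℤ
starExcess j = (1ℤ ℤ.- + j) ℤ.* (two^ j ℤ.- 1ℤ)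

starMass : ℕ → Dual
starMass j = + 2 ℤ.* two^ j ℤ.+ 1ℤ +ε starExcess j

scale : Dual → Weight → Weight
scale s ⟨ p , q , u ⟩ = ⟨ s ⊛ p , s ⊛ q , s ⊛ u ⟩

≡-weight : ∀ {p p′ q q′ u u′} → p ≡ p′ → q ≡ q′ → u ≡ u′ → ⟨ p , q , u ⟩ ≡ ⟨ p′ , q′ , u′ ⟩
≡-weight refl refl refl = refl

1≤two^ : ∀ j → 1ℤ ℤ.≤ two^ j
1≤two^ j = ℤ.+≤+ (ℕₚ.m^n>0 2 j)

two^-suc : ∀ j → two^ (suc j) ≡ + 2 ℤ.* two^ j
two^-suc j = ℤₚ.pos-* 2 (2 ^ j)

starExcess≤0 : ∀ j → starExcess j ℤ.≤ 0ℤ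
starExcess≤0 zero          = ℤₚ.≤-refl
starExcess≤0 (suc zero)    = ℤₚ.≤-refl
starExcess≤0 j@(suc (suc i)) = subst (ℤ._≤ 0ℤ) (lemma (+ j) (two^ j)) (ℤₚ.neg-mono-≤ {0ℤ}
   (*-nonneg (ℤₚ.i≤j⇒0≤j-i {1ℤ} {+ j} (ℤ.+≤+ (s≤s z≤n))) (ℤₚ.i≤j⇒0≤j-i (1≤two^ j))))
  where
  lemma : ∀ J P → ℤ.- ((J ℤ.- 1ℤ) ℤ.* (P ℤ.- 1ℤ)) ≡ (1ℤ ℤ.- J) ℤ.* (P ℤ.- 1ℤ)
  lemma = ℤ-Solver.solve-∀

3≤starMass : ∀ j → + 3 ℤ.≤ + 2 ℤ.* two^ j ℤ.+ 1ℤ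
3≤starMass j = ℤₚ.+-monoˡ-≤ 1ℤ (ℤₚ.*-monoˡ-≤-nonNeg (+ 2) (1≤two^ j))

fresh◂fresh : weight fresh ◂ weight fresh ≡ weight (support 0)
fresh◂fresh = refl

support◂fresh : ∀ j → weight (support j) ◂ weight fresh ≡ weight (support (suc j))
support◂fresh j = ≡-weight (cong₂ _+ε_ (trans (l₁ (two^ j)) (cong (+ 2 ℤ.*_) (≡.sym (two^-suc j))))
                                   (trans (l₂ (two^ j) (+ j)) (cong (ℤ._* (1ℤ ℤ.- + suc j)) (≡.sym (two^-suc j)))))
                           (cong₂ _+ε_ refl (l₃ (+ j)))
                           refl
  where
  l₁ : ∀ P → + 2 ℤ.* P ℤ.* + 2 ≡ + 2 ℤ.* (+ 2 ℤ.* P)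
  l₁ = ℤ-Solver.solve-∀
  l₂ : ∀ P J → + 2 ℤ.* P ℤ.* ℤ.-1ℤ ℤ.+ P ℤ.* (1ℤ ℤ.- J) ℤ.* + 2 ≡ + 2 ℤ.* P ℤ.* (1ℤ ℤ.- (1ℤ ℤ.+ J))
  l₂ = ℤ-Solver.solve-∀
  l₃ : ∀ J → 1ℤ ℤ.* 1ℤ ℤ.+ (J ℤ.- 1ℤ) ℤ.* 1ℤ ℤ.+ 0ℤ ≡ (1ℤ ℤ.+ J) ℤ.- 1ℤ
  l₃ = ℤ-Solver.solve-∀

-- With a leaf attached, the former hub is dominated whenever it is outside S, and the star centres
-- are always taken care of by their own leaves. So the stars split off as a scalar.
hub◂fresh : ∀ h → weight (hub h) ◂ weight fresh ≡ scale (M h +ε E h) (weight (support 0))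
hub◂fresh h = ≡-weight (cong₂ _+ε_ (l₁ (M h)) (l₂ (M h) (E h))) (cong₂ _+ε_ (l₃ (M h)) (l₄ (M h) (E h) (e h)))
                       (cong₂ _+ε_ (≡.sym (ℤₚ.*-zeroʳ (M h))) (l₅ (M h) (E h) (e h)))
  where
  l₁ : ∀ M → M ℤ.* + 2 ≡ M ℤ.* + 2
  l₁ = ℤ-Solver.solve-∀
  l₂ : ∀ M E → M ℤ.* ℤ.-1ℤ ℤ.+ (E ℤ.+ M) ℤ.* + 2 ≡ M ℤ.* 1ℤ ℤ.+ E ℤ.* + 2
  l₂ = ℤ-Solver.solve-∀
  l₃ : ∀ M → (M ℤ.- 1ℤ) ℤ.* 1ℤ ℤ.+ 1ℤ ≡ M ℤ.* 1ℤ
  l₃ = ℤ-Solver.solve-∀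
  l₄ : ∀ M E e → (M ℤ.- 1ℤ) ℤ.* 1ℤ ℤ.+ (E ℤ.- + 2 ℤ.* M ℤ.- e ℤ.+ + 2) ℤ.* 1ℤ ℤ.+ (1ℤ ℤ.+ (e ℤ.- + 2) ℤ.* 1ℤ)
       ≡ M ℤ.* ℤ.-1ℤ ℤ.+ E ℤ.* 1ℤ
  l₄ = ℤ-Solver.solve-∀
  l₅ : ∀ M E e → 0ℤ ℤ.+ (e ℤ.- + 2) ℤ.* 0ℤ ≡ M ℤ.* 0ℤ ℤ.+ E ℤ.* 0ℤ
  l₅ = ℤ-Solver.solve-∀

-- Each end, if outside S, is dominated by its own leaves, so the edge between them imposes no
-- condition and the pruned star splits off as a scalar.
support◂support : ∀ i j → weight (support i) ◂ weight (support j) ≡ scale (starMass j) (weight (support i))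
support◂support i j = ≡-weight (cong₂ _+ε_ (l₁ (two^ i) (two^ j)) (l₂ (two^ i) (two^ j) (+ i) (+ j)))
                               (cong₂ _+ε_ (l₃ (two^ j)) (l₄ (two^ j) (+ i) (+ j)))
                               (cong₂ _+ε_ (l₅ (two^ j)) (l₆ (two^ j) (starExcess j) (+ j)))
  where
  l₁ : ∀ P Q → + 2 ℤ.* P ℤ.* (+ 2 ℤ.* Q ℤ.+ 1ℤ ℤ.+ 0ℤ) ≡ (+ 2 ℤ.* Q ℤ.+ 1ℤ) ℤ.* (+ 2 ℤ.* P)
  l₁ = ℤ-Solver.solve-∀
  l₂ : ∀ P Q I J → + 2 ℤ.* P ℤ.* (Q ℤ.* (1ℤ ℤ.- J) ℤ.+ (J ℤ.- 1ℤ) ℤ.+ 0ℤ) ℤ.+ P ℤ.* (1ℤ ℤ.- I) ℤ.* (+ 2 ℤ.* Q ℤ.+ 1ℤ ℤ.+ 0ℤ)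
     ≡ (+ 2 ℤ.* Q ℤ.+ 1ℤ) ℤ.* (P ℤ.* (1ℤ ℤ.- I)) ℤ.+ (1ℤ ℤ.- J) ℤ.* (Q ℤ.- 1ℤ) ℤ.* (+ 2 ℤ.* P)
  l₂ = ℤ-Solver.solve-∀
  l₃ : ∀ Q → 1ℤ ℤ.* (+ 2 ℤ.* Q ℤ.+ 1ℤ) ℤ.+ 0ℤ ℤ.* (+ 2 ℤ.* Q) ≡ (+ 2 ℤ.* Q ℤ.+ 1ℤ) ℤ.* 1ℤ
  l₃ = ℤ-Solver.solve-∀
  l₄ : ∀ Q I J → 1ℤ ℤ.* (Q ℤ.* (1ℤ ℤ.- J) ℤ.+ (J ℤ.- 1ℤ)) ℤ.+ (I ℤ.- 1ℤ) ℤ.* (+ 2 ℤ.* Q ℤ.+ 1ℤ)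
                 ℤ.+ (0ℤ ℤ.* (Q ℤ.* (1ℤ ℤ.- J)) ℤ.+ 0ℤ ℤ.* (+ 2 ℤ.* Q))
     ≡ (+ 2 ℤ.* Q ℤ.+ 1ℤ) ℤ.* (I ℤ.- 1ℤ) ℤ.+ (1ℤ ℤ.- J) ℤ.* (Q ℤ.- 1ℤ) ℤ.* 1ℤ
  l₄ = ℤ-Solver.solve-∀
  l₅ : ∀ Q → 0ℤ ≡ (+ 2 ℤ.* Q ℤ.+ 1ℤ) ℤ.* 0ℤ
  l₅ = ℤ-Solver.solve-∀
  l₆ : ∀ Q X J → 0ℤ ℤ.* (J ℤ.- 1ℤ) ℤ.+ 0ℤ ≡ (+ 2 ℤ.* Q ℤ.+ 1ℤ) ℤ.* 0ℤ ℤ.+ X ℤ.* 0ℤ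
  l₆ = ℤ-Solver.solve-∀

-- The value of `e` comes from the only dominating set without the centre: it consists of j + 1 of
-- the j + 2 vertices, and 3(j + 1) - 2(j + 2) = j - 1.
starHub : ℕ → Hub
starHub j = record
  { M = + 2 ℤ.* two^ j ℤ.+ 1ℤ ; E = starExcess j ; e = + j ℤ.- 1ℤ
  ; 3≤M = 3≤starMass j ; E≤0 = starExcess≤0 j
  ; slack = subst (0ℤ ℤ.≤_) (lemma (two^ j) (+ j))
      (+-nonneg (*-nonneg {+ 2} (ℤ.+≤+ z≤n) (ℤₚ.i≤j⇒0≤j-i (1≤two^ j))) (*-nonneg {+ 2} {+ j} (ℤ.+≤+ z≤n) (ℤ.+≤+ z≤n))) }
  where
  lemma : ∀ P J → + 2 ℤ.* (P ℤ.- 1ℤ) ℤ.+ + 2 ℤ.* J ≡ + 2 ℤ.* P ℤ.+ 1ℤ ℤ.- 1ℤ ℤ.+ + 2 ℤ.* (J ℤ.- 1ℤ)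
  lemma = ℤ-Solver.solve-∀

-- Stars at one hub are independent: the totals M + Eε multiply and the excesses `e` add. The new
-- slack is the sum of the old ones plus (M h - 1)(M k - 1).
_⋆_ : Hub → Hub → Hub
h ⋆ k = record
  { M = M h ℤ.* M k ; E = M h ℤ.* E k ℤ.+ E h ℤ.* M k ; e = e h ℤ.+ e k
  ; 3≤M = ℤₚ.≤-trans (3≤M h) (subst (ℤ._≤ M h ℤ.* M k) (ℤₚ.*-identityʳ (M h))
           (*-mono-nonneg (0≤M h) ℤₚ.≤-refl (ℤ.+≤+ z≤n) (ℤₚ.≤-trans (ℤ.+≤+ (s≤s z≤n)) (3≤M k))))
  ; E≤0 = subst (ℤ._≤ 0ℤ) (l₁ (M h) (E h) (M k) (E k)) (ℤₚ.neg-mono-≤ {0ℤ}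
      (+-nonneg (*-nonneg (0≤M h) (ℤₚ.neg-mono-≤ (E≤0 k))) (*-nonneg (0≤M k) (ℤₚ.neg-mono-≤ (E≤0 h)))))
  ; slack = subst (0ℤ ℤ.≤_) (l₂ (M h) (e h) (M k) (e k)) (+-nonneg (+-nonneg (slack h) (slack k))
             (*-nonneg (0≤M-1 h) (0≤M-1 k))) }
  where
  0≤M : ∀ h → 0ℤ ℤ.≤ M h
  0≤M h = ℤₚ.≤-trans (ℤ.+≤+ z≤n) (3≤M h)
  l₁ : ∀ M E M′ E′ → ℤ.- (M ℤ.* (ℤ.- E′) ℤ.+ M′ ℤ.* (ℤ.- E)) ≡ M ℤ.* E′ ℤ.+ E ℤ.* M′
  l₁ = ℤ-Solver.solve-∀
  l₂ : ∀ M e M′ e′ → (M ℤ.- 1ℤ ℤ.+ + 2 ℤ.* e) ℤ.+ (M′ ℤ.- 1ℤ ℤ.+ + 2 ℤ.* e′) ℤ.+ (M ℤ.- 1ℤ) ℤ.* (M′ ℤ.- 1ℤ)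
     ≡ M ℤ.* M′ ℤ.- 1ℤ ℤ.+ + 2 ℤ.* (e ℤ.+ e′)
  l₂ = ℤ-Solver.solve-∀

fresh◂support : ∀ j → weight fresh ◂ weight (support j) ≡ weight (hub (starHub j))
fresh◂support j = ≡-weight (cong₂ _+ε_ (l₁ (two^ j)) (l₂ (two^ j) (+ j)))
                           (cong₂ _+ε_ (l₃ (two^ j)) (l₄ (two^ j) (+ j)))
                           (cong₂ _+ε_ refl (l₆ (+ j)))
  where
  l₁ : ∀ P → 1ℤ ℤ.* (+ 2 ℤ.* P ℤ.+ 1ℤ ℤ.+ 0ℤ) ≡ + 2 ℤ.* P ℤ.+ 1ℤ
  l₁ = ℤ-Solver.solve-∀
  l₂ : ∀ P J → 1ℤ ℤ.* (P ℤ.* (1ℤ ℤ.- J) ℤ.+ (J ℤ.- 1ℤ) ℤ.+ 0ℤ) ℤ.+ 1ℤ ℤ.* (+ 2 ℤ.* P ℤ.+ 1ℤ ℤ.+ 0ℤ)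
     ≡ (1ℤ ℤ.- J) ℤ.* (P ℤ.- 1ℤ) ℤ.+ (+ 2 ℤ.* P ℤ.+ 1ℤ)
  l₂ = ℤ-Solver.solve-∀
  l₃ : ∀ P → 0ℤ ℤ.* (+ 2 ℤ.* P ℤ.+ 1ℤ) ℤ.+ 1ℤ ℤ.* (+ 2 ℤ.* P) ≡ + 2 ℤ.* P ℤ.+ 1ℤ ℤ.- 1ℤ
  l₃ = ℤ-Solver.solve-∀
  l₄ : ∀ P J → 0ℤ ℤ.* (P ℤ.* (1ℤ ℤ.- J) ℤ.+ (J ℤ.- 1ℤ)) ℤ.+ 0ℤ ℤ.* (+ 2 ℤ.* P ℤ.+ 1ℤ)
                 ℤ.+ (1ℤ ℤ.* (P ℤ.* (1ℤ ℤ.- J)) ℤ.+ (ℤ.- + 2) ℤ.* (+ 2 ℤ.* P))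
     ≡ (1ℤ ℤ.- J) ℤ.* (P ℤ.- 1ℤ) ℤ.- + 2 ℤ.* (+ 2 ℤ.* P ℤ.+ 1ℤ) ℤ.- (J ℤ.- 1ℤ) ℤ.+ + 2
  l₄ = ℤ-Solver.solve-∀
  l₆ : ∀ J → 1ℤ ℤ.* (J ℤ.- 1ℤ) ℤ.+ (ℤ.- + 2) ℤ.* 1ℤ ≡ J ℤ.- 1ℤ ℤ.- + 2
  l₆ = ℤ-Solver.solve-∀

hub◂support : ∀ h j → weight (hub h) ◂ weight (support j) ≡ weight (hub (h ⋆ starHub j))
hub◂support h j = ≡-weight (cong₂ _+ε_ (l₁ (M h) (two^ j)) (l₂ (M h) (E h) (two^ j) (+ j)))
                           (cong₂ _+ε_ (l₃ (M h) (two^ j)) (l₄ (M h) (E h) (e h) (two^ j) (+ j)))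
                           (cong₂ _+ε_ refl (l₆ (e h) (+ j)))
  where
  l₁ : ∀ M P → M ℤ.* (+ 2 ℤ.* P ℤ.+ 1ℤ ℤ.+ 0ℤ) ≡ M ℤ.* (+ 2 ℤ.* P ℤ.+ 1ℤ)
  l₁ = ℤ-Solver.solve-∀
  l₂ : ∀ M E P J → M ℤ.* (P ℤ.* (1ℤ ℤ.- J) ℤ.+ (J ℤ.- 1ℤ) ℤ.+ 0ℤ) ℤ.+ (E ℤ.+ M) ℤ.* (+ 2 ℤ.* P ℤ.+ 1ℤ ℤ.+ 0ℤ)
     ≡ M ℤ.* ((1ℤ ℤ.- J) ℤ.* (P ℤ.- 1ℤ)) ℤ.+ E ℤ.* (+ 2 ℤ.* P ℤ.+ 1ℤ) ℤ.+ M ℤ.* (+ 2 ℤ.* P ℤ.+ 1ℤ)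
  l₂ = ℤ-Solver.solve-∀
  l₃ : ∀ M P → (M ℤ.- 1ℤ) ℤ.* (+ 2 ℤ.* P ℤ.+ 1ℤ) ℤ.+ 1ℤ ℤ.* (+ 2 ℤ.* P) ≡ M ℤ.* (+ 2 ℤ.* P ℤ.+ 1ℤ) ℤ.- 1ℤ
  l₃ = ℤ-Solver.solve-∀
  l₄ : ∀ M E e P J → (M ℤ.- 1ℤ) ℤ.* (P ℤ.* (1ℤ ℤ.- J) ℤ.+ (J ℤ.- 1ℤ)) ℤ.+ (E ℤ.- + 2 ℤ.* M ℤ.- e ℤ.+ + 2) ℤ.* (+ 2 ℤ.* P ℤ.+ 1ℤ)
                 ℤ.+ (1ℤ ℤ.* (P ℤ.* (1ℤ ℤ.- J)) ℤ.+ (e ℤ.- + 2) ℤ.* (+ 2 ℤ.* P))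
     ≡ M ℤ.* ((1ℤ ℤ.- J) ℤ.* (P ℤ.- 1ℤ)) ℤ.+ E ℤ.* (+ 2 ℤ.* P ℤ.+ 1ℤ)
       ℤ.- + 2 ℤ.* (M ℤ.* (+ 2 ℤ.* P ℤ.+ 1ℤ)) ℤ.- (e ℤ.+ (J ℤ.- 1ℤ)) ℤ.+ + 2
  l₄ = ℤ-Solver.solve-∀
  l₆ : ∀ e J → 1ℤ ℤ.* (J ℤ.- 1ℤ) ℤ.+ (e ℤ.- + 2) ℤ.* 1ℤ ≡ e ℤ.+ (J ℤ.- 1ℤ) ℤ.- + 2
  l₆ = ℤ-Solver.solve-∀

-- Signs of the ε-parts

weight-admissible : ∀ t → Admissible (weight t)
weight-admissible fresh = record
  { dominated-nonneg = ≤ʳ-refl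
  ; pending-nonneg   = ↑ ℤ.+≤+ z≤n
  ; inside-pos       = ↑ ℤ.+<+ (s≤s z≤n)
  ; outside≤inside   = ↑ ℤₚ.≤-refl }
weight-admissible (support j) = record
  { dominated-nonneg = ↑ ℤ.+≤+ z≤n
  ; pending-nonneg   = ≤ʳ-refl
  ; inside-pos       = ↑ *-pos {+ 2} (ℤ.+<+ (s≤s z≤n)) (ℤₚ.<-≤-trans (ℤ.+<+ (s≤s z≤n)) (1≤two^ j))
  ; outside≤inside   = ↑ *-mono-nonneg {1ℤ} {+ 2} (ℤ.+≤+ z≤n) (ℤ.+≤+ (s≤s z≤n)) (ℤ.+≤+ z≤n) (1≤two^ j) }
weight-admissible (hub h) = record
  { dominated-nonneg = ↑ 0≤M-1 h
  ; pending-nonneg   = ↑ ℤ.+≤+ z≤n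
  ; inside-pos       = ↑ ℤₚ.<-≤-trans (ℤ.+<+ (s≤s z≤n)) (3≤M h)
  ; outside≤inside   = ↑ ℤₚ.≤-reflexive (lemma (M h)) }
  where
  lemma : ∀ M → M ℤ.- 1ℤ ℤ.+ 1ℤ ≡ M
  lemma = ℤ-Solver.solve-∀

Zat-scale : ∀ {n} (G : Graph n) w x s t → Zat G w x (scale s t) ≡ s ⊛ Zat G w x t
Zat-scale G w x s ⟨ p , q , u ⟩ = lemma s p q u (inSum G w x) (outSum G w x) (hitSum G w x)
  where
  lemma : ∀ s p q u A B C → s ⊛ p ⊛ A ⊕ s ⊛ q ⊛ B ⊕ s ⊛ u ⊛ C ≡ s ⊛ (p ⊛ A ⊕ q ⊛ B ⊕ u ⊛ C)
  lemma = solve-∀ dual-ring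

-- Both halves of the theorem, the inequality and the equality case, pass through the induction in
-- this one statement.
Dichotomy : ℤ → Set → Set
Dichotomy i P = (i ≡ 0ℤ × P) ⊎ (i ℤ.< 0ℤ × ¬ P)

dichotomy-≤ : ∀ {i P} → Dichotomy i P → i ℤ.≤ 0ℤ
dichotomy-≤ (inj₁ (i≡0 , _)) = ℤₚ.≤-reflexive i≡0
dichotomy-≤ (inj₂ (i<0 , _)) = ℤₚ.<⇒≤ i<0

≤⇒dichotomy : ∀ {i} → i ℤ.≤ 0ℤ → Dichotomy i (i ≡ 0ℤ)
≤⇒dichotomy {i} i≤0 with i ℤ.≟ 0ℤ
... | yes i≡0 = inj₁ (i≡0 , i≡0)
... | no  i≢0 = inj₂ (ℤₚ.≤∧≢⇒< i≤0 i≢0 , i≢0)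

dichotomy-zero : ∀ {i P} → Dichotomy i P → P → i ≡ 0ℤ
dichotomy-zero (inj₁ (i≡0 , _)) _ = i≡0
dichotomy-zero (inj₂ (_ , ¬p))  p = contradiction p ¬p

dichotomy-tight : ∀ {i P} → Dichotomy i P → i ≡ 0ℤ → P
dichotomy-tight (inj₁ (_ , p))   _   = p
dichotomy-tight (inj₂ (i<0 , _)) i≡0 = contradiction i≡0 (ℤₚ.<⇒≢ i<0)

dichotomy-map : ∀ {i P Q} → (P → Q) → (Q → P) → Dichotomy i P → Dichotomy i Q
dichotomy-map to from (inj₁ (i≡0 , p)) = inj₁ (i≡0 , to p)
dichotomy-map to from (inj₂ (i<0 , ¬p)) = inj₂ (i<0 , ¬p ∘ from)

-- The ε-part of the product is re s · im z + im s · re z. With positive real parts both terms are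
-- nonpositive, so they cannot cancel, and the sum vanishes only if both do.
dichotomy-⊛ : ∀ s z {P Q} → Positive s → Positive z → Dichotomy (im s) P → Dichotomy (im z) Q →
              Dichotomy (im (s ⊛ z)) (P × Q)
dichotomy-⊛ (m +ε _) (r +ε _) _ _ (inj₁ (refl , p)) (inj₁ (refl , q)) =
  inj₁ (cong₂ ℤ._+_ (ℤₚ.*-zeroʳ m) (ℤₚ.*-zeroˡ r) , p , q)
dichotomy-⊛ (m +ε e) (r +ε i) (↑ 0<m) (↑ 0<r) (inj₂ (e<0 , ¬p)) d =
  inj₂ (subst (ℤ._< 0ℤ) (lemma m e r i) (ℤₚ.neg-mono-< {0ℤ} (ℤₚ.+-mono-≤-<
    (*-nonneg (ℤₚ.<⇒≤ 0<m) (ℤₚ.neg-mono-≤ (dichotomy-≤ d))) (*-pos (ℤₚ.neg-mono-< e<0) 0<r))) , ¬p ∘ proj₁)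
  where
  lemma : ∀ m e r i → ℤ.- (m ℤ.* (ℤ.- i) ℤ.+ (ℤ.- e) ℤ.* r) ≡ m ℤ.* i ℤ.+ e ℤ.* r
  lemma = ℤ-Solver.solve-∀
dichotomy-⊛ (m +ε _) (r +ε i) (↑ 0<m) _ (inj₁ (refl , p)) (inj₂ (i<0 , ¬q)) =
  inj₂ (subst (ℤ._< 0ℤ) (lemma m r i) (ℤₚ.neg-mono-< {0ℤ} (*-pos 0<m (ℤₚ.neg-mono-< i<0))) , ¬q ∘ proj₂)
  where
  lemma : ∀ m r i → ℤ.- (m ℤ.* (ℤ.- i)) ≡ m ℤ.* i ℤ.+ 0ℤ ℤ.* r
  lemma = ℤ-Solver.solve-∀

starMass-pos : ∀ j → Positive (starMass j)
starMass-pos j = ↑ ℤₚ.<-≤-trans (ℤ.+<+ (s≤s z≤n)) (3≤starMass j)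

-- In (1 - j)(2^j - 1) the second factor vanishes at j = 0 and the first at j = 1; from j = 2 on the
-- factors have opposite signs.
star-dichotomy : ∀ j → Dichotomy (starExcess j) (suc j ≤ 2)
star-dichotomy zero       = inj₁ (refl , s≤s z≤n)
star-dichotomy (suc zero) = inj₁ (refl , s≤s (s≤s z≤n))
star-dichotomy j@(suc (suc i)) = inj₂ (subst (ℤ._< 0ℤ) (lemma (+ j) (two^ j)) (ℤₚ.neg-mono-< {0ℤ}
    (*-pos {+ j ℤ.- 1ℤ} {two^ j ℤ.- 1ℤ} (ℤ.+<+ (s≤s z≤n)) (ℤₚ.<-≤-trans (ℤ.+<+ (s≤s z≤n)) (ℤₚ.+-monoˡ-≤ (ℤ.- 1ℤ) 2≤two^))))
  , λ { (s≤s (s≤s ())) })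
  where
  2≤two^ : + 2 ℤ.≤ two^ j
  2≤two^ = subst (+ 2 ℤ.≤_) (≡.sym (two^-suc (suc i))) (ℤₚ.*-monoˡ-≤-nonNeg (+ 2) (1≤two^ (suc i)))
  lemma : ∀ J P → ℤ.- ((J ℤ.- 1ℤ) ℤ.* (P ℤ.- 1ℤ)) ≡ (1ℤ ℤ.- J) ℤ.* (P ℤ.- 1ℤ)
  lemma = ℤ-Solver.solve-∀

hubMass : Hub → Dual
hubMass h = inside (weight (hub h)) ⊕ dominated (weight (hub h))

hubMass-pos : ∀ h → Positive (hubMass h)
hubMass-pos h = ↑ ℤₚ.+-mono-<-≤ (ℤₚ.<-≤-trans (ℤ.+<+ (s≤s z≤n)) (3≤M h)) (0≤M-1 h)

-- Twice the excess of an isolated hub is minus a sum of three terms that are nonnegative by `E≤0`,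
-- `slack` and `3≤M`; the doubling produces the 2e of the slack.
hubMass-excess : ∀ h → ℤ.- (+ 4 ℤ.* (ℤ.- E h) ℤ.+ (M h ℤ.- 1ℤ ℤ.+ + 2 ℤ.* e h) ℤ.+ (M h ℤ.- + 3)) ≡ + 2 ℤ.* im (hubMass h)
hubMass-excess h = lemma (M h) (E h) (e h)
  where
  lemma : ∀ M E e → ℤ.- (+ 4 ℤ.* (ℤ.- E) ℤ.+ (M ℤ.- 1ℤ ℤ.+ + 2 ℤ.* e) ℤ.+ (M ℤ.- + 3))
        ≡ + 2 ℤ.* (E ℤ.+ M ℤ.+ (E ℤ.- + 2 ℤ.* M ℤ.- e ℤ.+ + 2))
  lemma = ℤ-Solver.solve-∀

4E+slack-nonneg : ∀ h → 0ℤ ℤ.≤ + 4 ℤ.* (ℤ.- E h) ℤ.+ (M h ℤ.- 1ℤ ℤ.+ + 2 ℤ.* e h)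
4E+slack-nonneg h = +-nonneg (*-nonneg {+ 4} (ℤ.+≤+ z≤n) (ℤₚ.neg-mono-≤ (E≤0 h))) (slack h)

hubMass-excess≤0 : ∀ h → im (hubMass h) ℤ.≤ 0ℤ
hubMass-excess≤0 h = ℤₚ.*-cancelˡ-≤-pos (im (hubMass h)) 0ℤ (+ 2) (subst (ℤ._≤ 0ℤ) (hubMass-excess h)
  (ℤₚ.neg-mono-≤ {0ℤ} (+-nonneg (4E+slack-nonneg h) (ℤₚ.i≤j⇒0≤j-i (3≤M h)))))

-- Combining two hubs gives M ≥ 9, so the term M - 3 in `hubMass-excess` is strictly positive.
⋆-hubMass-negative : ∀ h k → im (hubMass (h ⋆ k)) ℤ.< 0ℤ
⋆-hubMass-negative h k = ℤₚ.*-cancelˡ-<-nonNeg (+ 2) (subst (ℤ._< 0ℤ) (hubMass-excess (h ⋆ k))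
  (ℤₚ.neg-mono-< {0ℤ} (ℤₚ.+-mono-≤-< (4E+slack-nonneg (h ⋆ k)) (ℤₚ.<-≤-trans (ℤ.+<+ (s≤s z≤n)) (ℤₚ.+-monoˡ-≤ (ℤ.- + 3) 9≤M)))))
  where
  9≤M : + 9 ℤ.≤ M h ℤ.* M k
  9≤M = *-mono-nonneg {+ 3} {_} {+ 3} (ℤ.+≤+ z≤n) (3≤M h) (ℤ.+≤+ z≤n) (3≤M k)

support-mass : ∀ j → inside (weight (support j)) ⊕ dominated (weight (support j)) ≡ starMass j
support-mass j = cong (+ 2 ℤ.* two^ j ℤ.+ 1ℤ +ε_) (lemma (two^ j) (+ j))
  where
  lemma : ∀ P J → P ℤ.* (1ℤ ℤ.- J) ℤ.+ (J ℤ.- 1ℤ) ≡ (1ℤ ℤ.- J) ℤ.* (P ℤ.- 1ℤ)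
  lemma = ℤ-Solver.solve-∀

linear : Dual → Dual → Dual → Weight → Dual
linear α β γ ⟨ p , q , u ⟩ = p ⊛ α ⊕ q ⊛ β ⊕ u ⊛ γ

-- This moves the functional from the root to the pruned vertex. The new coefficients belong to that
-- vertex being in S, being outside and already dominated, and being outside and needing the root in
-- S.
linear-◂ : ∀ A B C (w t : Weight) →
           linear A B C (w ◂ t) ≡ linear (inside w ⊛ A ⊕ (dominated w ⊕ pending w) ⊛ B) (linear A B C w) (inside w ⊛ A) t
linear-◂ A B C ⟨ p , q , u ⟩ ⟨ p′ , q′ , u′ ⟩ = lemma A B C p q u p′ q′ u′
  where
  lemma : ∀ A B C p q u p′ q′ u′ →
    p ⊛ (p′ ⊕ q′ ⊕ u′) ⊛ A ⊕ (q ⊛ (p′ ⊕ q′) ⊕ u ⊛ p′) ⊛ B ⊕ u ⊛ q′ ⊛ C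
    ≡ p′ ⊛ (p ⊛ A ⊕ (q ⊕ u) ⊛ B) ⊕ q′ ⊛ (p ⊛ A ⊕ q ⊛ B ⊕ u ⊛ C) ⊕ u′ ⊛ (p ⊛ A)
  lemma = solve-∀ dual-ring

-- Up to the correction below, twice the weight of a hub is (M - 1) times the neutral weight ⟨0,1,0⟩,
-- plus twice the weight of a leaf, plus M - 1 times the weight of a support vertex with one leaf.
hub-negative : ∀ α β γ h → 0ᴰ ≤ʳ α → Positive γ → γ ≤ʳ β → α ≤ʳ β ⊕ β → im β ℤ.≤ 0ℤ →
               im (linear α β γ (weight fresh)) ℤ.≤ 0ℤ → im (linear α β γ (weight (support 0))) ℤ.≤ 0ℤ →
               im (linear α β γ (weight (hub h))) ℤ.< 0ℤ
hub-negative (α₀ +ε α₁) (β₀ +ε β₁) (γ₀ +ε γ₁) h (↑ 0≤α) (↑ 0<γ) (↑ γ≤β) (↑ α≤2β) ∅≤0 F≤0 S≤0 =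
  ℤₚ.*-cancelˡ-<-nonNeg (+ 2) (subst (ℤ._< 0ℤ) (lemma (M h) (E h) (e h) α₀ α₁ β₀ β₁ γ₀ γ₁) (ℤₚ.neg-mono-< {0ℤ}
    (ℤₚ.+-mono-≤-< (+-nonneg (+-nonneg (+-nonneg (+-nonneg (+-nonneg
      (*-nonneg (0≤M-1 h) (ℤₚ.neg-mono-≤ ∅≤0))
      (*-nonneg {+ 2} (ℤ.+≤+ z≤n) (ℤₚ.neg-mono-≤ F≤0)))
      (*-nonneg (0≤M-1 h) (ℤₚ.neg-mono-≤ S≤0)))
      (*-nonneg {+ 2} (ℤ.+≤+ z≤n) (*-nonneg (ℤₚ.neg-mono-≤ (E≤0 h)) (+-nonneg 0≤α (ℤₚ.≤-trans (ℤₚ.<⇒≤ 0<γ) γ≤β)))))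
      (*-nonneg (0≤M-1 h) (ℤₚ.i≤j⇒0≤j-i α≤2β)))
      (*-nonneg (slack h) (ℤₚ.i≤j⇒0≤j-i γ≤β)))
      -- Strictness comes from this term alone.
      (*-pos 0<M-1 0<γ))))
  where
  0<M-1 : 0ℤ ℤ.< M h ℤ.- 1ℤ
  0<M-1 = ℤₚ.<-≤-trans (ℤ.+<+ (s≤s z≤n)) (ℤₚ.+-monoˡ-≤ (ℤ.- 1ℤ) (3≤M h))
  lemma : ∀ M E e α₀ α₁ β₀ β₁ γ₀ γ₁ →
    ℤ.- ((M ℤ.- 1ℤ) ℤ.* (ℤ.- β₁)
      ℤ.+ + 2 ℤ.* (ℤ.- ((1ℤ ℤ.* α₁ ℤ.+ 1ℤ ℤ.* α₀) ℤ.+ (0ℤ ℤ.* β₁ ℤ.+ 0ℤ ℤ.* β₀) ℤ.+ (1ℤ ℤ.* γ₁ ℤ.+ (ℤ.- + 2) ℤ.* γ₀)))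
      ℤ.+ (M ℤ.- 1ℤ) ℤ.* (ℤ.- ((+ 2 ℤ.* α₁ ℤ.+ 1ℤ ℤ.* α₀) ℤ.+ (1ℤ ℤ.* β₁ ℤ.+ ℤ.-1ℤ ℤ.* β₀) ℤ.+ (0ℤ ℤ.* γ₁ ℤ.+ 0ℤ ℤ.* γ₀)))
      ℤ.+ + 2 ℤ.* ((ℤ.- E) ℤ.* (α₀ ℤ.+ β₀))
      ℤ.+ (M ℤ.- 1ℤ) ℤ.* (β₀ ℤ.+ β₀ ℤ.- α₀)
      ℤ.+ (M ℤ.- 1ℤ ℤ.+ + 2 ℤ.* e) ℤ.* (β₀ ℤ.- γ₀)
      ℤ.+ (M ℤ.- 1ℤ) ℤ.* γ₀)
    ≡ + 2 ℤ.* ((M ℤ.* α₁ ℤ.+ (E ℤ.+ M) ℤ.* α₀)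
               ℤ.+ ((M ℤ.- 1ℤ) ℤ.* β₁ ℤ.+ (E ℤ.- + 2 ℤ.* M ℤ.- e ℤ.+ + 2) ℤ.* β₀)
               ℤ.+ (1ℤ ℤ.* γ₁ ℤ.+ (e ℤ.- + 2) ℤ.* γ₀))
  lemma = ℤ-Solver.solve-∀

module _ {n} (G : Graph n) {w : Fin n → Weight} (adm : ∀ v → Admissible (w v)) (x : Fin n)
         {t : Weight} (adm-t : Admissible t) where

  -- The three assumptions put the neutral weight, a leaf and a one-leaf support vertex in place of
  -- the hub. The first is about `t` itself, because attaching the neutral weight changes nothing.
  Zat-hub-negative : ∀ h → im (Zat G w x t) ℤ.≤ 0ℤ → im (Zat G w x (t ◂ weight fresh)) ℤ.≤ 0ℤ →
                     im (Zat G w x (t ◂ weight (support 0))) ℤ.≤ 0ℤ → im (Zat G w x (t ◂ weight (hub h))) ℤ.< 0ℤ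
  Zat-hub-negative h ∅≤0 F≤0 S≤0 = subst (λ z → im z ℤ.< 0ℤ) (≡.sym (linear-◂ A B C t (weight (hub h))))
    (hub-negative α β γ h
      (⊕-nonneg (↑ ℤₚ.<⇒≤ (↓ γ-pos)) q+uB≥0) γ-pos γ≤β α≤2β ∅≤0
      (subst (λ z → im z ℤ.≤ 0ℤ) (linear-◂ A B C t (weight fresh)) F≤0)
      (subst (λ z → im z ℤ.≤ 0ℤ) (linear-◂ A B C t (weight (support 0))) S≤0))
    where
    p q u A B C α β γ : Dual
    p = inside t
    q = dominated t
    u = pending t
    A = inSum G w x
    B = outSum G w x
    C = hitSum G w x
    α = p ⊛ A ⊕ (q ⊕ u) ⊛ B
    β = linear A B C t
    γ = p ⊛ A
    γ-pos : Positive γ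
    γ-pos = ⊛-pos (inside-pos adm-t) (inSum-pos G adm x)
    q+uB≥0 : 0ᴰ ≤ʳ (q ⊕ u) ⊛ B
    q+uB≥0 = ⊛-nonneg (⊕-nonneg (dominated-nonneg adm-t) (pending-nonneg adm-t)) (outSum-nonneg G adm x)
    γ≤β : γ ≤ʳ β
    γ≤β = ≤ʳ-trans (≤ʳ-⊕ (⊛-nonneg (dominated-nonneg adm-t) (outSum-nonneg G adm x)))
                   (≤ʳ-⊕ (⊛-nonneg (pending-nonneg adm-t) (hitSum-nonneg G adm x)))
    α≤2β : α ≤ʳ β ⊕ β
    -- The second summand (q + u)B of α is at most pA: q + u ≤ p by admissibility, and B ≤ A by
    -- adding `x` to S.
    α≤2β = ⊕-mono-≤ʳ γ≤β (≤ʳ-trans (⊛-mono-≤ʳ (⊕-nonneg (dominated-nonneg adm-t) (pending-nonneg adm-t)) (outside≤inside adm-t)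
                                       (outSum-nonneg G adm x) (outSum≤inSum G adm x)) γ≤β)

-- Leaves of forests

lookup-injective : ∀ {A : Set} {xs : List A} → Unique xs → ∀ i j → List.lookup xs i ≡ List.lookup xs j → i ≡ j
lookup-injective (x∉ ∷ u) zero    zero    eq = refl
lookup-injective {xs = _ ∷ xs} (x∉ ∷ u) zero    (suc j) eq = ⊥-elim (All.lookup x∉ (∈-lookup j) eq)
lookup-injective {xs = _ ∷ xs} (x∉ ∷ u) (suc i) zero    eq = ⊥-elim (All.lookup x∉ (∈-lookup i) (≡.sym eq))
lookup-injective (x∉ ∷ u) (suc i) (suc j) eq = cong suc (lookup-injective u i j eq)

unique-length : ∀ {n} {xs : List (Fin n)} → Unique xs → length xs ≤ n
unique-length u = injective⇒≤ (λ {i} {j} → lookup-injective u i j)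

unique-prefix : ∀ {A : Set} (xs : List A) {ys} → Unique (xs ++ ys) → Unique xs
unique-prefix []       _        = []
unique-prefix (x ∷ xs) (x∉ ∷ u) = Allₚ.++⁻ˡ xs x∉ ∷ unique-prefix xs u

module _ {n} (G : Graph n) where

  walk-prefix : ∀ xs {ys} → Walk G (xs ++ ys) → Walk G xs
  walk-prefix []           _       = tt
  walk-prefix (x ∷ [])     _       = tt
  walk-prefix (x ∷ y ∷ xs) (e , w) = e , walk-prefix (y ∷ xs) w

  lastOf-∷ʳ : ∀ x xs u → lastOf G x (xs ++ u ∷ []) ≡ u
  lastOf-∷ʳ x []       u = refl
  lastOf-∷ʳ x (y ∷ xs) u = lastOf-∷ʳ y xs u

  PendantTo : Fin n → Fin n → Set
  PendantTo ℓ x = adj G ℓ x ≡ true × (∀ y → adj G ℓ y ≡ true → y ≡ x)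

  -- The part of the path from `v` to `u` is closed by the chord. It has at least three vertices
  -- because `u` comes after `p`.
  chord⇒cycle : ∀ {v p ps u} → Unique (v ∷ p ∷ ps) → Walk G (v ∷ p ∷ ps) → adj G v u ≡ true → u ∈ ps →
                ∃ (IsCycle G)
  chord⇒cycle {v} {p} {ps} {u} uniq walk vu u∈ps with ∈-∃++ u∈ps
  ... | as , bs , refl = v ∷ p ∷ as ++ u ∷ []
      , s≤s (s≤s (subst (1 ≤_) (≡.sym (length-++ as)) (ℕₚ.m≤n+m 1 (length as))))
      , unique-prefix (v ∷ p ∷ as ++ u ∷ []) (subst (λ zs → Unique (v ∷ p ∷ zs)) (≡.sym (++-assoc as (u ∷ []) bs)) uniq)
      , walk-prefix (v ∷ p ∷ as ++ u ∷ []) (subst (λ zs → Walk G (v ∷ p ∷ zs)) (≡.sym (++-assoc as (u ∷ []) bs)) walk)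
      , subst (λ z → adj G z v ≡ true) (≡.sym (lastOf-∷ʳ p as u)) (trans (Graph.sym G u v) vu)

  module _ (forest : IsForest G) where

    -- A path grows at its head `v`. If `v` has no neighbour besides its predecessor `p`, it is
    -- pendant; any other neighbour lies off the path, since a chord would close a cycle. When
    -- `fuel` runs out, the path would have more than `n` distinct vertices.
    extend : ∀ fuel v p ps → Unique (v ∷ p ∷ ps) → Walk G (v ∷ p ∷ ps) → n ℕ.< fuel ℕ.+ length (v ∷ p ∷ ps) →
             ∃ λ ℓ → ∃ λ x → PendantTo ℓ x
    extend zero       v p ps uniq walk long = contradiction (unique-length uniq) (ℕₚ.<⇒≱ long)
    extend (suc fuel) v p ps uniq walk@(vp , _) long
      with any? (λ u → (adj G v u Bool.≟ true) ×-dec ¬? (u ≟ p))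
    ... | no stuck = v , p , vp , only
      where
      only : ∀ y → adj G v y ≡ true → y ≡ p
      only y vy with y ≟ p
      ... | yes y≡p = y≡p
      ... | no  y≢p = contradiction (y , vy , y≢p) stuck
    ... | yes (u , vu , u≢p) = extend fuel u v (p ∷ ps) ((u≢v ∷ u≢p ∷ u∉ps) ∷ uniq) (trans (Graph.sym G u v) vu , walk)
                                 (subst (n ℕ.<_) (≡.sym (ℕₚ.+-suc fuel _)) long)
      where
      u≢v : u ≢ v
      u≢v refl = contradiction (trans (≡.sym vu) (irrefl G v)) λ ()
      u∉ps : All (u ≢_) ps
      u∉ps = All.tabulate (λ {y} y∈ps u≡y →
        let c , cyc = chord⇒cycle uniq walk vu (subst (_∈ ps) (≡.sym u≡y) y∈ps) in forest c cyc)

    isolated-or-pendant : Fin n → ∃ λ ℓ → (∀ y → adj G ℓ y ≡ false) ⊎ ∃ (PendantTo ℓ)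
    isolated-or-pendant r with any? (λ u → adj G r u Bool.≟ true)
    ... | no none = r , inj₁ (λ y → ¬-not (λ e → none (y , e)))
    ... | yes (u , ru) =
      let ℓ , x , leaf = extend n u r [] ((u≢r ∷ []) ∷ [] ∷ []) (trans (Graph.sym G u r) ru , tt) (ℕₚ.m<m+n n (s≤s z≤n))
      in ℓ , inj₂ (x , leaf)
      where
      u≢r : u ≢ r
      u≢r refl = contradiction (trans (≡.sym ru) (irrefl G r)) λ ()

delete-forest : ∀ {n} (G : Graph (suc n)) ℓ → IsForest G → IsForest (delete G ℓ)
delete-forest G ℓ forest (x ∷ xs) (long , uniq , walk , closed) = forest (map (punchIn ℓ) (x ∷ xs))
  ( subst (3 ≤_) (cong suc (≡.sym (length-map (punchIn ℓ) xs))) long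
  , Uniqueₚ.map⁺ (punchIn-injective ℓ _ _) uniq
  , walk-map (x ∷ xs) walk
  , subst (λ z → adj G z (punchIn ℓ x) ≡ true) (lastOf-map x xs) closed)
  where
  walk-map : ∀ ys → Walk (delete G ℓ) ys → Walk G (map (punchIn ℓ) ys)
  walk-map []           _       = tt
  walk-map (x ∷ [])     _       = tt
  walk-map (x ∷ y ∷ ys) (e , w) = e , walk-map (y ∷ ys) w
  lastOf-map : ∀ x ys → punchIn ℓ (lastOf (delete G ℓ) x ys) ≡ lastOf G (punchIn ℓ x) (map (punchIn ℓ) ys)
  lastOf-map x []       = refl
  lastOf-map x (y ∷ ys) = lastOf-map y ys

-- Pruning

module ∑ = Sum ℕₚ.+-0-commutativeMonoid

bit : Bool → ℕ
bit b = if b then 1 else 0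

count : ∀ {n} → (Fin n → Bool) → ℕ
count f = ∑.sum (bit ∘ f)

count-cong : ∀ {n} {f g : Fin n → Bool} → (∀ v → f v ≡ g v) → count f ≡ count g
count-cong f≡g = ∑.sum-cong-≗ (cong bit ∘ f≡g)

count-remove : ∀ {n} (i : Fin (suc n)) f → count f ≡ bit (f i) ℕ.+ count (f ∘ punchIn i)
count-remove i f = ∑.sum-remove {i = i} (bit ∘ f)

count-none : ∀ {n} {f : Fin n → Bool} → (∀ v → f v ≡ false) → count f ≡ 0
count-none {n} none = trans (count-cong none) (∑.sum-replicate-zero n)

count-true : ∀ {n} {f : Fin n → Bool} i → f i ≡ true → ∃ λ k → count f ≡ suc k
count-true {suc n} {f} i fi = count (f ∘ punchIn i) , trans (count-remove i f) (cong (λ b → bit b ℕ.+ count (f ∘ punchIn i)) fi)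

count-zero : ∀ {n} {f : Fin n → Bool} → count f ≡ 0 → ∀ i → f i ≡ false
count-zero {f = f} c≡0 i = ¬-not (λ fi → contradiction (trans (≡.sym c≡0) (proj₂ (count-true {f = f} i fi))) λ ())

count-one : ∀ {n} {f : Fin n → Bool} → count f ≡ 1 → ∀ {i j} → f i ≡ true → f j ≡ true → i ≡ j
count-one {suc n} {f} c≡1 {i} {j} fi fj with i ≟ j
... | yes i≡j = i≡j
... | no  i≢j = contradiction (trans (≡.sym fj) (subst (λ k → f k ≡ false) (punchIn-punchOut i≢j) (count-zero none (punchOut i≢j)))) λ ()
  where
  none : count (f ∘ punchIn i) ≡ 0
  none = ℕₚ.suc-injective (trans (cong (λ b → bit b ℕ.+ count (f ∘ punchIn i)) (≡.sym fi)) (trans (≡.sym (count-remove i f)) c≡1))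

count-single : ∀ {n} {f : Fin n → Bool} i → (∀ j → j ≢ i → f j ≡ false) → count f ≡ bit (f i)
count-single {suc n} {f} i only = trans (count-remove i f)
  (trans (cong (bit (f i) ℕ.+_) (count-none (λ j → only _ (punchInᵢ≢i i j)))) (ℕₚ.+-identityʳ _))

deg : ∀ {n} → Graph n → Fin n → ℕ
deg G v = count (adj G v)

isFresh : Kind → Bool
isFresh fresh = true
isFresh _     = false

-- A vertex with a pruned part has lost neighbours, so having degree one now does not make it a leaf
-- of the original forest.
freshLeaf : ∀ {n} → Graph n → (Fin n → Kind) → Fin n → Bool
freshLeaf G κ v = isFresh (κ v) ∧ (deg G v ℕ.≡ᵇ 1)

freshLeaves : ∀ {n} → Graph n → (Fin n → Kind) → Fin n → ℕ
freshLeaves G κ v = count (λ y → adj G v y ∧ freshLeaf G κ y)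

deg≡0⇒freshLeaves≡0 : ∀ {n} (G : Graph n) κ v → deg G v ≡ 0 → freshLeaves G κ v ≡ 0
deg≡0⇒freshLeaves≡0 G κ v d≡0 = count-none (λ y → cong (_∧ freshLeaf G κ y) (count-zero d≡0 y))

-- The local condition for equality at a vertex with d neighbours, l of which are leaves without a
-- pruned part.  An isolated hub may be the end of a path on three vertices, which attains equality.
GoodKind : Kind → ℕ → ℕ → Set
GoodKind fresh       d l = d ≡ 1 ⊎ (1 ≤ l × l ≤ 2)
GoodKind (support j) d l = suc j ℕ.+ l ≤ 2
GoodKind (hub h)     d l = (E h ≡ 0ℤ × 1 ≤ l × l ≤ 2) ⊎ (d ≡ 0 × im (hubMass h) ≡ 0ℤ)

GoodAt : ∀ {n} → Graph n → (Fin n → Kind) → Fin n → Set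
GoodAt G κ v = GoodKind (κ v) (deg G v) (freshLeaves G κ v)

Good : ∀ {n} → Graph n → (Fin n → Kind) → Set
Good G κ = ∀ v → GoodAt G κ v

-- An isolated fresh vertex has total 1 + ε, with positive ε-part. Vertices of the other kinds may
-- become isolated during the pruning.
NoIsolatedFresh : ∀ {n} → Graph n → (Fin n → Kind) → Set
NoIsolatedFresh G κ = ∀ v → κ v ≡ fresh → deg G v ≢ 0

Claim : ∀ {n} → Graph n → (Fin n → Kind) → Set
Claim G κ = Dichotomy (im (Z G (weight ∘ κ))) (Good G κ)

punch-cases : ∀ {n} {P : Fin (suc n) → Set} ℓ → P ℓ → (∀ v → P (punchIn ℓ v)) → ∀ v → P v
punch-cases {P = P} ℓ pℓ p v with ℓ ≟ v
... | yes refl = pℓ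
... | no  ℓ≢v  = subst P (punchIn-punchOut ℓ≢v) (p (punchOut ℓ≢v))

point-cases : ∀ {n} {P : Fin n → Set} x → P x → (∀ v → v ≢ x → P v) → ∀ v → P v
point-cases x px p v with v ≟ x
... | yes refl = px
... | no  v≢x  = p v v≢x

_[_↦_] : ∀ {n} → (Fin n → Kind) → Fin n → Kind → Fin n → Kind
(κ [ x ↦ k ]) v = if does (v ≟ x) then k else κ v

↦-same : ∀ {n} (κ : Fin n → Kind) x k → (κ [ x ↦ k ]) x ≡ k
↦-same κ x k with x ≟ x
... | yes _   = refl
... | no  x≢x = contradiction refl x≢x

↦-other : ∀ {n} (κ : Fin n → Kind) {x v} k → v ≢ x → (κ [ x ↦ k ]) v ≡ κ v
↦-other κ {x} {v} k v≢x with v ≟ x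
... | yes v≡x = contradiction v≡x v≢x
... | no  _   = refl

module Isolated {n} (G : Graph (suc n)) (κ : Fin (suc n) → Kind) (ℓ : Fin (suc n))
                (iso : ∀ y → adj G ℓ y ≡ false) where

  G′ = delete G ℓ
  κ′ = κ ∘ punchIn ℓ

  deg-delete : ∀ v → deg G (punchIn ℓ v) ≡ deg G′ v
  deg-delete v = trans (count-remove ℓ (adj G (punchIn ℓ v)))
    (cong (λ b → bit b ℕ.+ deg G′ v) (trans (Graph.sym G (punchIn ℓ v) ℓ) (iso (punchIn ℓ v))))

  freshLeaves-delete : ∀ v → freshLeaves G κ (punchIn ℓ v) ≡ freshLeaves G′ κ′ v
  freshLeaves-delete v = trans (count-remove ℓ (λ y → adj G (punchIn ℓ v) y ∧ freshLeaf G κ y)) (cong₂ ℕ._+_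
    (cong (λ b → bit (b ∧ freshLeaf G κ ℓ)) (trans (Graph.sym G (punchIn ℓ v) ℓ) (iso (punchIn ℓ v))))
    (count-cong (λ y → cong (λ d → adj G′ v y ∧ (isFresh (κ′ y) ∧ (d ℕ.≡ᵇ 1))) (deg-delete y))))

  goodAt-delete : ∀ v → GoodAt G κ (punchIn ℓ v) ≡ GoodAt G′ κ′ v
  goodAt-delete v = cong₂ (GoodKind (κ′ v)) (deg-delete v) (freshLeaves-delete v)

  deg-ℓ : deg G ℓ ≡ 0
  deg-ℓ = count-none iso

  noIsolatedFresh : NoIsolatedFresh G κ → NoIsolatedFresh G′ κ′
  noIsolatedFresh ni v eq d≡0 = ni (punchIn ℓ v) eq (trans (deg-delete v) d≡0)

  claim : ∀ {k m P} → κ ℓ ≡ k → inside (weight k) ⊕ dominated (weight k) ≡ m → Positive m → Dichotomy (im m) P →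
          (P → GoodKind k 0 0) → (GoodKind k 0 0 → P) → Claim G′ κ′ → Claim G κ
  claim {k} {m} {P} refl mass m-pos m-dich to from ih = subst (λ z → Dichotomy (im z) (Good G κ))
      (≡.sym (trans (Z-isolated G (weight ∘ κ) ℓ (iso ∘ punchIn ℓ)) (cong (_⊛ Z G′ (weight ∘ κ′)) mass)))
      (dichotomy-map good good⁻¹ (dichotomy-⊛ m (Z G′ (weight ∘ κ′)) m-pos (Z-pos G′ (weight-admissible ∘ κ′)) m-dich ih))
    where
    at-ℓ : GoodAt G κ ℓ ≡ GoodKind (κ ℓ) 0 0
    at-ℓ = cong₂ (GoodKind (κ ℓ)) deg-ℓ (deg≡0⇒freshLeaves≡0 G κ ℓ deg-ℓ)
    good : P × Good G′ κ′ → Good G κ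
    good (p , g) = punch-cases ℓ (subst id (≡.sym at-ℓ) (to p)) (λ v → subst id (≡.sym (goodAt-delete v)) (g v))
    good⁻¹ : Good G κ → P × Good G′ κ′
    good⁻¹ g = from (subst id at-ℓ (g ℓ)) , λ v → subst id (goodAt-delete v) (g (punchIn ℓ v))

-- This covers the prunings that only split off a scalar; `Tight` tells when its ε-part vanishes. By
-- `not-fresh` the neighbour is afterwards mistaken neither for a leaf of the original forest nor
-- for an isolated fresh vertex.
record Absorption (k t : Kind) : Set₁ where
  field
    mass        : Dual
    result      : Kind
    Tight       : Set
    absorb-≡    : weight k ◂ weight t ≡ scale mass (weight result)
    mass-pos    : Positive mass
    mass-tight  : Dichotomy (im mass) Tight
    not-fresh   : isFresh result ≡ false
open Absorption

unscaled : ∀ {k t} r → weight k ◂ weight t ≡ weight r → isFresh r ≡ false → Absorption k t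
unscaled r eq nf = record
  { mass = 1ᴰ ; result = r ; Tight = ⊤
  ; absorb-≡ = trans eq (≡-weight (≡.sym (⊛-identityˡ _)) (≡.sym (⊛-identityˡ _)) (≡.sym (⊛-identityˡ _)))
  ; mass-pos = 1ᴰ-pos ; mass-tight = inj₁ (refl , tt) ; not-fresh = nf }

absorbFresh : ∀ k → Absorption k fresh
absorbFresh fresh       = unscaled (support 0) fresh◂fresh refl
absorbFresh (support j) = unscaled (support (suc j)) (support◂fresh j) refl
absorbFresh (hub h)     = record
  { mass = M h +ε E h ; result = support 0 ; Tight = E h ≡ 0ℤ
  ; absorb-≡ = hub◂fresh h
  ; mass-pos = ↑ ℤₚ.<-≤-trans (ℤ.+<+ (s≤s z≤n)) (3≤M h)
  ; mass-tight = ≤⇒dichotomy (E≤0 h) ; not-fresh = refl }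

absorbSupport : ∀ k j → Absorption k (support j)
absorbSupport fresh       j = unscaled (hub (starHub j)) (fresh◂support j) refl
absorbSupport (support i) j = record
  { mass = starMass j ; result = support i ; Tight = suc j ≤ 2
  ; absorb-≡ = support◂support i j ; mass-pos = starMass-pos j ; mass-tight = star-dichotomy j ; not-fresh = refl }
absorbSupport (hub h)     j = unscaled (hub (h ⋆ starHub j)) (hub◂support h j) refl

-- Pruning a leaf of the remaining forest

module Pendant {n} (G : Graph (suc n)) (κ : Fin (suc n) → Kind) (ℓ : Fin (suc n)) (x : Fin n)
               (ℓx : adj G ℓ (punchIn ℓ x) ≡ true) (only : ∀ y → y ≢ x → adj G ℓ (punchIn ℓ y) ≡ false) where

  G′ = delete G ℓ
  κ₀ = κ ∘ punchIn ℓ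
  X  = punchIn ℓ x

  deg-X : deg G X ≡ suc (deg G′ x)
  deg-X = trans (count-remove ℓ (adj G X)) (cong (λ b → bit b ℕ.+ deg G′ x) (trans (Graph.sym G X ℓ) ℓx))

  adj-ℓ-other : ∀ {v} → v ≢ x → adj G (punchIn ℓ v) ℓ ≡ false
  adj-ℓ-other {v} v≢x = trans (Graph.sym G (punchIn ℓ v) ℓ) (only v v≢x)

  deg-other : ∀ {v} → v ≢ x → deg G (punchIn ℓ v) ≡ deg G′ v
  deg-other {v} v≢x = trans (count-remove ℓ (adj G (punchIn ℓ v))) (cong (λ b → bit b ℕ.+ deg G′ v) (adj-ℓ-other v≢x))

  deg-ℓ : deg G ℓ ≡ 1
  deg-ℓ = trans (count-remove ℓ (adj G ℓ)) (cong₂ ℕ._+_ (cong bit (irrefl G ℓ))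
    (trans (count-single {f = adj G ℓ ∘ punchIn ℓ} x only) (cong bit ℓx)))

  freshLeaves-ℓ : freshLeaves G κ ℓ ≡ bit (freshLeaf G κ X)
  freshLeaves-ℓ = trans (count-remove ℓ (λ y → adj G ℓ y ∧ freshLeaf G κ y)) (cong₂ ℕ._+_
    (cong (λ b → bit (b ∧ freshLeaf G κ ℓ)) (irrefl G ℓ))
    (trans (count-single {f = λ y → adj G ℓ (punchIn ℓ y) ∧ freshLeaf G κ (punchIn ℓ y)} x
             (λ y y≢x → cong (_∧ freshLeaf G κ (punchIn ℓ y)) (only y y≢x)))
           (cong (λ b → bit (b ∧ freshLeaf G κ X)) ℓx)))

  module _ (k : Kind) where

    κ′ = κ₀ [ x ↦ k ]

    Z-replace : Z G′ (weight ∘ κ′) ≡ Zat G′ (weight ∘ κ₀) x (weight k)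
    Z-replace = trans (Z-at G′ x (λ v v≢x → cong weight (↦-other κ₀ k v≢x)))
                      (cong (Zat G′ (weight ∘ κ₀) x ∘ weight) (↦-same κ₀ x k))

    noIsolatedFresh : NoIsolatedFresh G κ → (k ≡ fresh → deg G′ x ≢ 0) → NoIsolatedFresh G′ κ′
    noIsolatedFresh ni at-x v eq d≡0 with v ≟ x
    ... | yes refl = at-x eq d≡0
    ... | no  v≢x  = ni (punchIn ℓ v) eq (trans (deg-other v≢x) d≡0)

    module _ (nf : isFresh k ≡ false) where

      -- Only `x` changes its kind or degree. If `v` is adjacent to `x`, then `X` has degree at
      -- least two in `G`, and after the pruning `x` is not fresh; so it counts as a fresh leaf on
      -- neither side.
      freshLeaf-delete : ∀ v y → adj G′ v y ∧ freshLeaf G κ (punchIn ℓ y) ≡ adj G′ v y ∧ freshLeaf G′ κ′ y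
      freshLeaf-delete v y with y ≟ x
      ... | no y≢x   = cong (λ d → adj G′ v y ∧ (isFresh (κ₀ y) ∧ (d ℕ.≡ᵇ 1))) (deg-other y≢x)
      ... | yes refl with adj G′ v x in vx
      ...   | false = refl
      ...   | true  = trans (cong (isFresh (κ₀ x) ∧_) (≡1-false
                              (trans deg-X (cong suc (proj₂ (count-true v (trans (Graph.sym G′ x v) vx)))))))
                            (trans (∧-zeroʳ _) (≡.sym (cong (_∧ _) nf)))
        where
        ≡1-false : ∀ {d m} → d ≡ suc (suc m) → (d ℕ.≡ᵇ 1) ≡ false
        ≡1-false refl = refl

      freshLeaves-delete : ∀ v → freshLeaves G κ (punchIn ℓ v) ≡ bit (adj G (punchIn ℓ v) ℓ ∧ freshLeaf G κ ℓ) ℕ.+ freshLeaves G′ κ′ v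
      freshLeaves-delete v = trans (count-remove ℓ (λ y → adj G (punchIn ℓ v) y ∧ freshLeaf G κ y))
        (cong (bit (adj G (punchIn ℓ v) ℓ ∧ freshLeaf G κ ℓ) ℕ.+_) (count-cong (freshLeaf-delete v)))

      goodAt-other : ∀ {v} → v ≢ x → GoodAt G κ (punchIn ℓ v) ≡ GoodAt G′ κ′ v
      goodAt-other {v} v≢x = trans
        (cong (λ t → GoodKind t (deg G (punchIn ℓ v)) (freshLeaves G κ (punchIn ℓ v))) (≡.sym (↦-other κ₀ k v≢x)))
        (cong₂ (GoodKind (κ′ v)) (deg-other v≢x)
          (trans (freshLeaves-delete v) (cong (λ b → bit (b ∧ freshLeaf G κ ℓ) ℕ.+ freshLeaves G′ κ′ v) (adj-ℓ-other v≢x))))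

      goodAt-X : GoodAt G κ X ≡ GoodKind (κ X) (suc (deg G′ x)) (bit (freshLeaf G κ ℓ) ℕ.+ freshLeaves G′ κ′ x)
      goodAt-X = cong₂ (GoodKind (κ X)) deg-X
        (trans (freshLeaves-delete x) (cong (λ b → bit (b ∧ freshLeaf G κ ℓ) ℕ.+ freshLeaves G′ κ′ x) (trans (Graph.sym G X ℓ) ℓx)))

      goodAt-x : GoodAt G′ κ′ x ≡ GoodKind k (deg G′ x) (freshLeaves G′ κ′ x)
      goodAt-x = cong (λ t → GoodKind t (deg G′ x) (freshLeaves G′ κ′ x)) (↦-same κ₀ x k)

  goodAt-ℓ : GoodAt G κ ℓ ≡ GoodKind (κ ℓ) 1 (bit (freshLeaf G κ X))
  goodAt-ℓ = cong₂ (GoodKind (κ ℓ)) deg-ℓ freshLeaves-ℓ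

  Zat-absorb : ∀ {t} (a : Absorption (κ X) t) →
               Zat G′ (weight ∘ κ₀) x (weight (κ X) ◂ weight t) ≡ mass a ⊛ Z G′ (weight ∘ κ′ (result a))
  Zat-absorb {t} a = begin
    Zat G′ (weight ∘ κ₀) x (weight (κ X) ◂ weight t)              ≡⟨ cong (Zat G′ (weight ∘ κ₀) x) (absorb-≡ a) ⟩
    Zat G′ (weight ∘ κ₀) x (scale (mass a) (weight (result a)))   ≡⟨ Zat-scale G′ (weight ∘ κ₀) x (mass a) (weight (result a)) ⟩
    mass a ⊛ Zat G′ (weight ∘ κ₀) x (weight (result a))           ≡⟨ cong (mass a ⊛_) (Z-replace (result a)) ⟨
    mass a ⊛ Z G′ (weight ∘ κ′ (result a)) ∎
    where open ≡-Reasoning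

  absorb-dichotomy : ∀ {t} (a : Absorption (κ X) t) → Claim G′ (κ′ (result a)) →
                     Dichotomy (im (Zat G′ (weight ∘ κ₀) x (weight (κ X) ◂ weight t))) (Tight a × Good G′ (κ′ (result a)))
  absorb-dichotomy a ih = subst (λ z → Dichotomy (im z) (Tight a × Good G′ (κ′ (result a)))) (≡.sym (Zat-absorb a))
    (dichotomy-⊛ (mass a) (Z G′ (weight ∘ κ′ (result a))) (mass-pos a)
      (Z-pos G′ (weight-admissible ∘ κ′ (result a))) (mass-tight a) ih)

  Z-prune : Z G (weight ∘ κ) ≡ Zat G′ (weight ∘ κ₀) x (weight (κ X) ◂ weight (κ ℓ))
  Z-prune = Z-leaf G (weight ∘ κ) ℓ x ℓx only

  -- The conditions at all other vertices are unchanged, so for each pair of kinds only an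
  -- equivalence concerning `ℓ` and `X` remains to be checked.
  claim : ∀ {kX kℓ c₁ c₂} → κ X ≡ kX → κ ℓ ≡ kℓ → freshLeaf G κ X ≡ c₁ → freshLeaf G κ ℓ ≡ c₂ → (a : Absorption kX kℓ) →
          let k = result a ; d = deg G′ x ; l = freshLeaves G′ (κ′ k) x in
          (GoodKind kℓ 1 (bit c₁) × GoodKind kX (suc d) (bit c₂ ℕ.+ l) → Tight a × GoodKind k d l) →
          (Tight a × GoodKind k d l → GoodKind kℓ 1 (bit c₁) × GoodKind kX (suc d) (bit c₂ ℕ.+ l)) →
          Claim G′ (κ′ k) → Claim G κ
  claim refl refl refl refl a to from ih = subst (λ z → Dichotomy (im z) (Good G κ)) (≡.sym Z-prune)
      (dichotomy-map good good⁻¹ (absorb-dichotomy a ih))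
    where
    k = result a
    good : Tight a × Good G′ (κ′ k) → Good G κ
    good (t , g) = punch-cases ℓ (subst id (≡.sym goodAt-ℓ) (proj₁ both))
      (point-cases x (subst id (≡.sym (goodAt-X k (not-fresh a))) (proj₂ both))
        (λ v v≢x → subst id (≡.sym (goodAt-other k (not-fresh a) v≢x)) (g v)))
      where both = from (t , subst id (goodAt-x k (not-fresh a)) (g x))
    good⁻¹ : Good G κ → Tight a × Good G′ (κ′ k)
    good⁻¹ g = proj₁ both , point-cases x (subst id (≡.sym (goodAt-x k (not-fresh a))) (proj₂ both))
        (λ v v≢x → subst id (goodAt-other k (not-fresh a) v≢x) (g (punchIn ℓ v)))
      where both = to (subst id goodAt-ℓ (g ℓ) , subst id (goodAt-X k (not-fresh a)) (g X))

  module _ (ni : NoIsolatedFresh G κ) (ih : ∀ κ″ → NoIsolatedFresh G′ κ″ → Claim G′ κ″) where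

    ih-absorbed : ∀ {k t} (a : Absorption k t) → Claim G′ (κ′ (result a))
    ih-absorbed a = ih _ (noIsolatedFresh (result a) ni
      (λ r≡fresh → contradiction (trans (≡.sym (not-fresh a)) (cong isFresh r≡fresh)) λ ()))

    fresh-claim : κ ℓ ≡ fresh → Claim G κ
    fresh-claim κℓ = go (κ X) refl
      where
      ℓ-freshLeaf : freshLeaf G κ ℓ ≡ true
      ℓ-freshLeaf = cong₂ (λ t m → isFresh t ∧ (m ℕ.≡ᵇ 1)) κℓ deg-ℓ
      go : ∀ k → κ X ≡ k → Claim G κ
      go fresh κX = claim κX κℓ refl ℓ-freshLeaf (absorbFresh fresh)
        -- If `X` has degree one too, `ℓ` and `X` form a single edge, and `x` is left as an isolated
        -- support vertex with one leaf.
        (λ { (_ , inj₁ d+1≡1) → tt , s≤s (ℕₚ.≤-trans (ℕₚ.≤-reflexive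
               (deg≡0⇒freshLeaves≡0 G′ (κ′ (support 0)) x (ℕₚ.suc-injective d+1≡1))) z≤n)
           ; (_ , inj₂ (_ , l≤2)) → tt , l≤2 })
        (λ (_ , l≤2) → inj₁ refl , inj₂ (s≤s z≤n , l≤2))
        (ih-absorbed (absorbFresh fresh))
      go (support j) κX = claim κX κℓ refl ℓ-freshLeaf (absorbFresh (support j))
        (λ (_ , le) → tt , subst (_≤ 2) (ℕₚ.+-suc (suc j) _) le)
        (λ (_ , le) → inj₁ refl , subst (_≤ 2) (≡.sym (ℕₚ.+-suc (suc j) _)) le)
        (ih-absorbed (absorbFresh (support j)))
      go (hub h) κX = claim κX κℓ refl ℓ-freshLeaf (absorbFresh (hub h))
        (λ { (_ , inj₁ (E≡0 , _ , l≤2)) → E≡0 , l≤2 ; (_ , inj₂ (() , _)) })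
        (λ (E≡0 , l≤2) → inj₁ refl , inj₁ (E≡0 , s≤s z≤n , l≤2))
        (ih-absorbed (absorbFresh (hub h)))

    module _ (X-not-leaf : freshLeaf G κ X ≡ false) where

      -- A fresh `X` with no neighbour besides `ℓ` would be a fresh leaf.
      fresh⇒deg≢0 : κ X ≡ fresh → deg G′ x ≢ 0
      fresh⇒deg≢0 κX d≡0 = contradiction (trans (≡.sym X-not-leaf)
        (cong₂ (λ t m → isFresh t ∧ (m ℕ.≡ᵇ 1)) κX (trans deg-X (cong suc d≡0)))) λ ()

      support-claim : ∀ j → κ ℓ ≡ support j → Claim G κ
      support-claim j κℓ = go (κ X) refl
        where
        ℓ-not-freshLeaf : freshLeaf G κ ℓ ≡ false
        ℓ-not-freshLeaf = cong (λ t → isFresh t ∧ (deg G ℓ ℕ.≡ᵇ 1)) κℓ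
        +0 : suc j ℕ.+ 0 ≤ 2 → suc j ≤ 2
        +0 = subst (_≤ 2) (ℕₚ.+-identityʳ (suc j))
        +0⁻¹ : suc j ≤ 2 → suc j ℕ.+ 0 ≤ 2
        +0⁻¹ = subst (_≤ 2) (≡.sym (ℕₚ.+-identityʳ (suc j)))
        go : ∀ k → κ X ≡ k → Claim G κ
        go fresh κX = claim κX κℓ X-not-leaf ℓ-not-freshLeaf (absorbSupport fresh j)
          (λ { (_ , inj₁ d+1≡1) → contradiction (ℕₚ.suc-injective d+1≡1) (fresh⇒deg≢0 κX)
             ; (le , inj₂ ls) → tt , inj₁ (dichotomy-zero (star-dichotomy j) (+0 le) , ls) })
          (λ { (_ , inj₁ (E≡0 , ls)) → +0⁻¹ (dichotomy-tight (star-dichotomy j) E≡0) , inj₂ ls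
             ; (_ , inj₂ (d≡0 , _)) → contradiction d≡0 (fresh⇒deg≢0 κX) })
          (ih-absorbed (absorbSupport fresh j))
        go (support i) κX = claim κX κℓ X-not-leaf ℓ-not-freshLeaf (absorbSupport (support i) j)
          (λ (le , g) → +0 le , g) (λ (le , g) → +0⁻¹ le , g)
          (ih-absorbed (absorbSupport (support i) j))
        go (hub h) κX = claim κX κℓ X-not-leaf ℓ-not-freshLeaf (absorbSupport (hub h) j)
          (λ { (le , inj₁ (E≡0 , ls)) → tt , inj₁ (dichotomy-zero excess (E≡0 , +0 le) , ls) ; (_ , inj₂ (() , _)) })
          (λ { (_ , inj₁ (E≡0 , ls)) → let E≡0′ , le = dichotomy-tight excess E≡0 in +0⁻¹ le , inj₁ (E≡0′ , ls)
             -- The equality case of an isolated hub cannot arise here, since there are at least two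
             -- stars.
             ; (_ , inj₂ (_ , im≡0)) → contradiction im≡0 (ℤₚ.<⇒≢ (⋆-hubMass-negative h (starHub j))) })
          (ih-absorbed (absorbSupport (hub h) j))
          where
          excess : Dichotomy (E (h ⋆ starHub j)) (E h ≡ 0ℤ × suc j ≤ 2)
          excess = dichotomy-⊛ (M h +ε E h) (starMass j) (↑ ℤₚ.<-≤-trans (ℤ.+<+ (s≤s z≤n)) (3≤M h)) (starMass-pos j)
                     (≤⇒dichotomy (E≤0 h)) (star-dichotomy j)

      -- The induction hypothesis is used for three kinds at `x` in the same smaller graph: that of
      -- `X`, that after absorbing a leaf, and that after absorbing a one-leaf star. The attached
      -- leaf or star adds no vertex, as it is recorded in the kind.
      hub-claim : ∀ h → κ ℓ ≡ hub h → Claim G κ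
      hub-claim h κℓ = inj₂ (subst (λ z → im z ℤ.< 0ℤ) (≡.sym Z-prune)
          (subst (λ t → im (Zat G′ (weight ∘ κ₀) x (weight (κ X) ◂ weight t)) ℤ.< 0ℤ) (≡.sym κℓ)
            (Zat-hub-negative G′ (weight-admissible ∘ κ₀) x (weight-admissible (κ X)) h
              (subst (λ z → im z ℤ.≤ 0ℤ) (Z-replace (κ X)) (dichotomy-≤ (ih _ (noIsolatedFresh (κ X) ni fresh⇒deg≢0))))
              (dichotomy-≤ (absorb-dichotomy (absorbFresh (κ X)) (ih-absorbed (absorbFresh (κ X)))))
              (dichotomy-≤ (absorb-dichotomy (absorbSupport (κ X) 0) (ih-absorbed (absorbSupport (κ X) 0)))))) , not-good)
        where
        not-good : ¬ Good G κ
        -- A hub of degree one is not isolated, and its only neighbour is not a fresh leaf, so both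
        -- alternatives of `GoodKind` fail.
        not-good g with subst id goodAt-ℓ (g ℓ)
        ... | good-ℓ rewrite κℓ | X-not-leaf with good-ℓ
        ...   | inj₁ (_ , () , _)
        ...   | inj₂ (() , _)

-- Induction on the number of vertices

pendant-index : ∀ {n} (G : Graph (suc n)) {ℓ X} → PendantTo G ℓ X →
                ∃ λ x → X ≡ punchIn ℓ x × adj G ℓ (punchIn ℓ x) ≡ true × (∀ y → y ≢ x → adj G ℓ (punchIn ℓ y) ≡ false)
pendant-index G {ℓ} {X} (ℓX , only) = x , ≡.sym X≡ , trans (cong (adj G ℓ) X≡) ℓX
  , λ y y≢x → ¬-not (λ e → y≢x (punchIn-injective ℓ y x (trans (only _ e) (≡.sym X≡))))
  where
  ℓ≢X : ℓ ≢ X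
  ℓ≢X refl = contradiction (trans (≡.sym ℓX) (irrefl G ℓ)) λ ()
  x = punchOut ℓ≢X
  X≡ : punchIn ℓ x ≡ X
  X≡ = punchIn-punchOut ℓ≢X

freshLeaf-true : ∀ {n} (G : Graph n) κ v → freshLeaf G κ v ≡ true → κ v ≡ fresh × deg G v ≡ 1
freshLeaf-true G κ v = go (κ v) (deg G v)
  where
  go : ∀ k d → isFresh k ∧ (d ℕ.≡ᵇ 1) ≡ true → k ≡ fresh × d ≡ 1
  go fresh 1 _ = refl , refl

-- The statement ranges over all `κ`, because pruning changes the kind of the neighbour and a hub
-- needs several kinds there at once.
forest-claim : ∀ n (G : Graph n) κ → IsForest G → NoIsolatedFresh G κ → Claim G κ
forest-claim zero    G κ forest ni = inj₁ (refl , λ ())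
forest-claim (suc n) G κ forest ni with isolated-or-pendant G forest zero
... | ℓ , inj₁ iso = go (κ ℓ) refl
  where
  open Isolated G κ ℓ iso hiding (claim)
  ih : Claim G′ κ′
  ih = forest-claim n G′ κ′ (delete-forest G ℓ forest) (noIsolatedFresh ni)
  go : ∀ k → κ ℓ ≡ k → Claim G κ
  go fresh       κℓ = contradiction deg-ℓ (ni ℓ κℓ)
  go (support j) κℓ = Isolated.claim G κ ℓ iso κℓ (support-mass j) (starMass-pos j) (star-dichotomy j)
    (subst (_≤ 2) (≡.sym (ℕₚ.+-identityʳ (suc j)))) (subst (_≤ 2) (ℕₚ.+-identityʳ (suc j))) ih
  go (hub h)     κℓ = Isolated.claim G κ ℓ iso κℓ refl (hubMass-pos h) (≤⇒dichotomy (hubMass-excess≤0 h))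
    (λ im≡0 → inj₂ (refl , im≡0)) (λ { (inj₁ (_ , () , _)) ; (inj₂ (_ , im≡0)) → im≡0 }) ih
... | ℓ , inj₂ (X , pendant@(ℓX , only)) = go (κ ℓ) refl (freshLeaf G κ X) refl
  where
  ih : ∀ ℓ κ′ → NoIsolatedFresh (delete G ℓ) κ′ → Claim (delete G ℓ) κ′
  ih ℓ κ′ = forest-claim n (delete G ℓ) κ′ (delete-forest G ℓ forest)
  prune-fresh : ∀ {ℓ X} → PendantTo G ℓ X → κ ℓ ≡ fresh → Claim G κ
  prune-fresh {ℓ} p κℓ = let x , _ , ℓx , only = pendant-index G p in Pendant.fresh-claim G κ ℓ x ℓx only ni (ih ℓ) κℓ
  go : ∀ k → κ ℓ ≡ k → ∀ b → freshLeaf G κ X ≡ b → Claim G κ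
  go fresh κℓ _ _ = prune-fresh pendant κℓ
  -- Here `ℓ` and `X` form an isolated edge with `X` fresh, so the roles are exchanged and `X` is
  -- pruned.
  go _ _ true X-leaf = let κX , d≡1 = freshLeaf-true G κ X X-leaf ; Xℓ = trans (Graph.sym G X ℓ) ℓX in
    prune-fresh {X} {ℓ} (Xℓ , λ y Xy → count-one {f = adj G X} d≡1 Xy Xℓ) κX
  go (support j) κℓ false X-not-leaf with pendant-index G pendant
  ... | x , refl , ℓx , only = Pendant.support-claim G κ ℓ x ℓx only ni (ih ℓ) X-not-leaf j κℓ
  go (hub h) κℓ false X-not-leaf with pendant-index G pendant
  ... | x , refl , ℓx , only = Pendant.hub-claim G κ ℓ x ℓx only ni (ih ℓ) X-not-leaf h κℓ

-- Dominating sets and their average order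

module ⋀ = Sum ∧-commutativeMonoid

any-tabulate : ∀ {n} {A : Set} (p : A → Bool) (g : Fin n → A) → any p (tabulate g) ≡ ⋁.sum (p ∘ g)
any-tabulate {zero}  p g = refl
any-tabulate {suc n} p g = cong (p (g zero) ∨_) (any-tabulate p (g ∘ suc))

all-tabulate : ∀ {n} {A : Set} (p : A → Bool) (g : Fin n → A) → all p (tabulate g) ≡ ⋀.sum (p ∘ g)
all-tabulate {zero}  p g = refl
all-tabulate {suc n} p g = cong (p (g zero) ∧_) (all-tabulate p (g ∘ suc))

length-filterᵇ-tabulate : ∀ {n} {A : Set} (p : A → Bool) (g : Fin n → A) → length (filterᵇ p (tabulate g)) ≡ count (p ∘ g)
length-filterᵇ-tabulate {zero}  p g = refl
length-filterᵇ-tabulate {suc n} p g with p (g zero)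
... | true  = cong suc (length-filterᵇ-tabulate p (g ∘ suc))
... | false = length-filterᵇ-tabulate p (g ∘ suc)

∑ᴸ : ∀ {A : Set} → (A → Dual) → List A → Dual
∑ᴸ f []       = 0ᴰ
∑ᴸ f (x ∷ xs) = f x ⊕ ∑ᴸ f xs

∑ᴸ-concatMap : ∀ {A B : Set} (f : B → Dual) (g h : A → B) xs →
               ∑ᴸ f (concatMap (λ x → g x ∷ h x ∷ []) xs) ≡ ∑ᴸ (λ x → f (g x) ⊕ f (h x)) xs
∑ᴸ-concatMap f g h []       = refl
∑ᴸ-concatMap f g h (x ∷ xs) = trans (cong (λ z → f (g x) ⊕ (f (h x) ⊕ z)) (∑ᴸ-concatMap f g h xs)) (lemma (f (g x)) (f (h x)) _)
  where
  lemma : ∀ a b c → a ⊕ (b ⊕ c) ≡ (a ⊕ b) ⊕ c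
  lemma = solve-∀ dual-ring

-- The subsets in `allSubsets` are functions and can be compared only pointwise with those read off
-- from vectors.
Extensional : ∀ {n} → ((Fin n → Bool) → Dual) → Set
Extensional f = ∀ {S S′} → S ≗ S′ → f S ≡ f S′

∑ˢ-allSubsets : ∀ n (f : (Fin n → Bool) → Dual) → Extensional f → ∑ˢ n (f ∘ lookup) ≡ ∑ᴸ f (allSubsets n)
∑ˢ-allSubsets zero    f ext = trans (ext (λ ())) (lemma _)
  where
  lemma : ∀ a → a ≡ a ⊕ 0ᴰ
  lemma = solve-∀ dual-ring
-- The function that prefixes a bit in `allSubsets` is local there, so `step` treats arbitrary `g`
-- and `h` with the right values.
∑ˢ-allSubsets (suc n) f ext = step _ _ (λ { S zero → refl ; S (suc i) → refl }) (λ { S zero → refl ; S (suc i) → refl })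
  where
  cons : Bool → (Fin n → Bool) → Fin (suc n) → Bool
  cons b S zero    = b
  cons b S (suc i) = S i
  step : ∀ g h → (∀ S → g S ≗ cons false S) → (∀ S → h S ≗ cons true S) →
         ∑ˢ (suc n) (f ∘ lookup) ≡ ∑ᴸ f (concatMap (λ S → g S ∷ h S ∷ []) (allSubsets n))
  step g h g≗ h≗ = trans
    (∑ˢ-cong n (λ S → cong₂ _⊕_
      (ext (λ { zero → ≡.sym (g≗ (lookup S) zero) ; (suc i) → ≡.sym (g≗ (lookup S) (suc i)) }))
      (ext (λ { zero → ≡.sym (h≗ (lookup S) zero) ; (suc i) → ≡.sym (h≗ (lookup S) (suc i)) }))))
    (trans (∑ˢ-allSubsets n (λ S → f (g S) ⊕ f (h S)) (λ {S} {S′} S≗S′ → cong₂ _⊕_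
        (ext {g S} {g S′} (congᶜ {k = g} g≗ S≗S′))
        (ext {h S} {h S′} (congᶜ {k = h} h≗ S≗S′))))
      (≡.sym (∑ᴸ-concatMap f g h (allSubsets n))))
    where
    congᶜ : ∀ {b} {k : (Fin n → Bool) → Fin (suc n) → Bool} → (∀ S → k S ≗ cons b S) → ∀ {S S′} → S ≗ S′ → k S ≗ k S′
    congᶜ k≗ {S} {S′} S≗S′ zero    = trans (k≗ S zero) (≡.sym (k≗ S′ zero))
    congᶜ k≗ {S} {S′} S≗S′ (suc i) = trans (k≗ S (suc i)) (trans (S≗S′ i) (≡.sym (k≗ S′ (suc i))))

excess : ℕ → ℕ → ℤ
excess n k = + 3 ℤ.* + k ℤ.- + 2 ℤ.* + n

-- As ε² = 0, (1 + ε)^k (1 - 2ε)^(n-k) = 1 + (3k - 2n)ε; a vertex neither chosen nor hit contributes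
-- the factor 0.
∏-fresh : ∀ {n} (f h : Fin n → Bool) →
          Π.sum (λ v → local (weight fresh) (f v) (h v))
            ≡ (if ⋀.sum (λ v → f v ∨ h v) then 1ℤ +ε excess n (count f) else 0ᴰ)
∏-fresh {zero}  f h = refl
∏-fresh {suc n} f h with f zero | h zero | ∏-fresh (f ∘ suc) (h ∘ suc)
... | false | false | _ = annihilate _
  where
  annihilate : ∀ x → 0ᴰ ⊛ x ≡ 0ᴰ
  annihilate = solve-∀ dual-ring
... | true  | _     | ih = trans (cong (_ ⊛_) ih) (go (⋀.sum (λ v → f (suc v) ∨ h (suc v))))
  where
  lemma : ∀ k n → 1ℤ ℤ.* (+ 3 ℤ.* k ℤ.- + 2 ℤ.* n) ℤ.+ 1ℤ ℤ.* 1ℤ ≡ + 3 ℤ.* (1ℤ ℤ.+ k) ℤ.- + 2 ℤ.* (1ℤ ℤ.+ n)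
  lemma = ℤ-Solver.solve-∀
  go : ∀ b → (1ℤ +ε 1ℤ) ⊛ (if b then 1ℤ +ε excess n (count (f ∘ suc)) else 0ᴰ)
           ≡ (if b then 1ℤ +ε excess (suc n) (suc (count (f ∘ suc))) else 0ᴰ)
  go true  = cong (1ℤ +ε_) (lemma (+ count (f ∘ suc)) (+ n))
  go false = refl
... | false | true  | ih = trans (cong (_ ⊛_) ih) (go (⋀.sum (λ v → f (suc v) ∨ h (suc v))))
  where
  lemma : ∀ k n → 1ℤ ℤ.* (+ 3 ℤ.* k ℤ.- + 2 ℤ.* n) ℤ.+ (ℤ.- + 2) ℤ.* 1ℤ ≡ + 3 ℤ.* k ℤ.- + 2 ℤ.* (1ℤ ℤ.+ n)
  lemma = ℤ-Solver.solve-∀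
  go : ∀ b → (1ℤ +ε ℤ.- + 2) ⊛ (if b then 1ℤ +ε excess n (count (f ∘ suc)) else 0ᴰ)
           ≡ (if b then 1ℤ +ε excess (suc n) (count (f ∘ suc)) else 0ᴰ)
  go true  = cong (1ℤ +ε_) (lemma (+ count (f ∘ suc)) (+ n))
  go false = refl

module _ {n} (G : Graph n) where

  isDominating-⋀ : ∀ S → isDominating G S ≡ ⋀.sum (λ v → S v ∨ ⋁.sum (λ u → S u ∧ adj G u v))
  isDominating-⋀ S = trans (all-tabulate {n} (λ v → S v ∨ any (λ u → S u ∧ adj G u v) (allFin n)) id)
    (⋀.sum-cong-≗ (λ v → cong (S v ∨_) (any-tabulate {n} (λ u → S u ∧ adj G u v) id)))

  size-count : ∀ S → size G S ≡ count S
  size-count S = length-filterᵇ-tabulate S id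

  term : (Fin n → Bool) → Dual
  term S = if isDominating G S then 1ℤ +ε excess n (size G S) else 0ᴰ

  term-⋀ : ∀ S → term S ≡ (if ⋀.sum (λ v → S v ∨ ⋁.sum (λ u → S u ∧ adj G u v)) then 1ℤ +ε excess n (count S) else 0ᴰ)
  term-⋀ S = cong₂ (λ b k → if b then 1ℤ +ε excess n k else 0ᴰ) (isDominating-⋀ S) (size-count S)

  term-extensional : Extensional term
  term-extensional {S} {S′} S≗S′ = trans (term-⋀ S) (trans
    (cong₂ (λ b k → if b then 1ℤ +ε excess n k else 0ᴰ)
      (⋀.sum-cong-≗ (λ v → cong₂ _∨_ (S≗S′ v) (⋁.sum-cong-≗ (λ u → cong (_∧ adj G u v) (S≗S′ u)))))
      (count-cong S≗S′))
    (≡.sym (term-⋀ S′)))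

  total : ℕ
  total = sumᴸ (map (size G) (dominatingSets G))

  ∑ᴸ-term : ∀ L → ∑ᴸ term L ≡ + length (filterᵇ (isDominating G) L)
                    +ε + 3 ℤ.* + sumᴸ (map (size G) (filterᵇ (isDominating G) L))
                       ℤ.- + 2 ℤ.* + n ℤ.* + length (filterᵇ (isDominating G) L)
  ∑ᴸ-term []      = cong (0ℤ +ε_) (lemma (+ n))
    where
    lemma : ∀ n → 0ℤ ≡ + 3 ℤ.* 0ℤ ℤ.- + 2 ℤ.* n ℤ.* 0ℤ
    lemma = ℤ-Solver.solve-∀
  ∑ᴸ-term (S ∷ L) with isDominating G S
  ... | false = trans (lemma _) (∑ᴸ-term L)
    where
    lemma : ∀ a → 0ᴰ ⊕ a ≡ a
    lemma = solve-∀ dual-ring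
  ... | true  = trans (cong ((1ℤ +ε excess n (size G S)) ⊕_) (∑ᴸ-term L))
                      (cong (+ suc (length (filterᵇ (isDominating G) L)) +ε_)
                        (lemma (+ size G S) (+ sumᴸ (map (size G) (filterᵇ (isDominating G) L))) (+ n) (+ length (filterᵇ (isDominating G) L))))
    where
    lemma : ∀ k s n c → (+ 3 ℤ.* k ℤ.- + 2 ℤ.* n) ℤ.+ (+ 3 ℤ.* s ℤ.- + 2 ℤ.* n ℤ.* c)
                      ≡ + 3 ℤ.* (k ℤ.+ s) ℤ.- + 2 ℤ.* n ℤ.* (1ℤ ℤ.+ c)
    lemma = ℤ-Solver.solve-∀

  -- This links `Z` with `avd`: the sign of the ε-part compares the average order with 2n/3.
  Z-fresh : Z G (λ _ → weight fresh) ≡ + length (dominatingSets G)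
                 +ε + 3 ℤ.* + total ℤ.- + 2 ℤ.* + n ℤ.* + length (dominatingSets G)
  Z-fresh = begin
    Z G (λ _ → weight fresh)         ≡⟨ ∑ˢ-cong n (λ S → trans (∏-fresh (lookup S) (hit G S)) (≡.sym (term-⋀ (lookup S)))) ⟩
    ∑ˢ n (term ∘ lookup)             ≡⟨ ∑ˢ-allSubsets n term term-extensional ⟩
    ∑ᴸ term (allSubsets n)           ≡⟨ ∑ᴸ-term (allSubsets n) ⟩
    _ ∎
    where open ≡-Reasoning

  degree-deg : ∀ v → degree G v ≡ deg G v
  degree-deg v = length-filterᵇ-tabulate (adj G v) id

  isLeaf-≡ᵇ : ∀ v → isLeaf G v ≡ (deg G v ℕ.≡ᵇ 1)
  isLeaf-≡ᵇ v = trans go (cong (ℕ._≡ᵇ 1) (degree-deg v))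
    where
    go : isLeaf G v ≡ (degree G v ℕ.≡ᵇ 1)
    go with degree G v
    ... | 0           = refl
    ... | 1           = refl
    ... | suc (suc _) = refl

  leafNeighbours-freshLeaves : ∀ v → leafNeighbours G v ≡ freshLeaves G (λ _ → fresh) v
  leafNeighbours-freshLeaves v = trans (length-filterᵇ-tabulate (λ u → adj G v u ∧ isLeaf G u) id)
    (count-cong (λ u → cong (adj G v u ∧_) (isLeaf-≡ᵇ u)))

  EqualityCondition : Set
  EqualityCondition = ∀ v → ¬ IsLeaf G v → IsSupport G v × leafNeighbours G v ≤ 2

  good⇒condition : Good G (λ _ → fresh) → EqualityCondition
  good⇒condition good v ¬leaf with good v
  ... | inj₁ d≡1 = contradiction (trans (degree-deg v) d≡1) ¬leaf
  ... | inj₂ ls  = subst (λ l → 1 ≤ l × l ≤ 2) (≡.sym (leafNeighbours-freshLeaves v)) ls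

  condition⇒good : EqualityCondition → Good G (λ _ → fresh)
  condition⇒good cond v with deg G v ℕ.≟ 1
  ... | yes d≡1 = inj₁ d≡1
  ... | no  d≢1 = inj₂ (subst (λ l → 1 ≤ l × l ≤ 2) (leafNeighbours-freshLeaves v) (cond v (d≢1 ∘ trans (≡.sym (degree-deg v)))))

  noIsolated⇒ : NoIsolated G → NoIsolatedFresh G (λ _ → fresh)
  noIsolated⇒ ni v _ d≡0 = let u , vu = ni v in contradiction (trans (≡.sym vu) (count-zero d≡0 u)) λ ()

-- Comparing fractions by cross-multiplication

ratio-≤ : ∀ s c a → 0ℤ ℤ.< + c → + s ℤ.* + 3 ℤ.≤ + a ℤ.* + c → ratio s c Q.≤ (+ a) / 3
ratio-≤ s zero    a (ℤ.+<+ ()) _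
-- Denominators are stored minus one: `mkℚᵘ (+ a) 2` is a/3 and `mkℚᵘ (+ s) d` is s/(d + 1).
ratio-≤ s (suc d) a _ le = Qₚ.toℚᵘ-cancel-≤ (ℚᵘₚ.≤-respʳ-≃ (ℚᵘₚ.≃-sym (Qₚ.toℚᵘ-fromℚᵘ (mkℚᵘ (+ a) 2)))
  (ℚᵘₚ.≤-respˡ-≃ (ℚᵘₚ.≃-sym (Qₚ.toℚᵘ-fromℚᵘ (mkℚᵘ (+ s) d))) (*≤* le)))

ratio-≡ : ∀ s c a → 0ℤ ℤ.< + c → + s ℤ.* + 3 ≡ + a ℤ.* + c → ratio s c ≡ (+ a) / 3
ratio-≡ s zero    a (ℤ.+<+ ()) _
ratio-≡ s (suc d) a _ eq = Qₚ.fromℚᵘ-cong {mkℚᵘ (+ s) d} {mkℚᵘ (+ a) 2} (*≡* eq)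

ratio-≡⁻¹ : ∀ s c a → 0ℤ ℤ.< + c → ratio s c ≡ (+ a) / 3 → + s ℤ.* + 3 ≡ + a ℤ.* + c
ratio-≡⁻¹ s zero    a (ℤ.+<+ ()) _
ratio-≡⁻¹ s (suc d) a _ eq with *≡* eq′ ← Qₚ.fromℚᵘ-injective {mkℚᵘ (+ s) d} {mkℚᵘ (+ a) 2} eq = eq′

theorem3p4 : ∀ (n : ℕ) (G : Graph n) → IsForest G → NoIsolated G →
    (avd G Q.≤ (+ (2 * n)) / 3)
    × ((avd G ≡ (+ (2 * n)) / 3) ⇔
    (∀ (v : Fin n) → ¬ IsLeaf G v → IsSupport G v × leafNeighbours G v ≤ 2))
theorem3p4 n G forest ni =
    ratio-≤ s c (2 * n) c-pos (ℤₚ.0≤i-j⇒j≤i (subst (0ℤ ℤ.≤_) difference (ℤₚ.neg-mono-≤ (dichotomy-≤ dich))))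
  , mk⇔ (λ eq → good⇒condition G (dichotomy-tight dich
          (trans (≡.sym difference′) (ℤₚ.i≡j⇒i-j≡0 (ratio-≡⁻¹ s c (2 * n) c-pos eq)))))
        (λ cond → ratio-≡ s c (2 * n) c-pos
          (ℤₚ.i-j≡0⇒i≡j _ _ (trans difference′ (dichotomy-zero dich (condition⇒good G cond)))))
  where
  s c : ℕ
  s = total G
  c = length (dominatingSets G)
  i : ℤ
  i = + 3 ℤ.* + s ℤ.- + 2 ℤ.* + n ℤ.* + c
  difference′ : + s ℤ.* + 3 ℤ.- + (2 * n) ℤ.* + c ≡ i
  difference′ = trans (cong (λ m → + s ℤ.* + 3 ℤ.- m ℤ.* + c) (ℤₚ.pos-* 2 n)) (lemma (+ s) (+ n) (+ c))
    where
    lemma : ∀ s n c → s ℤ.* + 3 ℤ.- + 2 ℤ.* n ℤ.* c ≡ + 3 ℤ.* s ℤ.- + 2 ℤ.* n ℤ.* c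
    lemma = ℤ-Solver.solve-∀
  difference : ℤ.- i ≡ + (2 * n) ℤ.* + c ℤ.- + s ℤ.* + 3
  difference = trans (cong ℤ.-_ (≡.sym difference′)) (lemma (+ s ℤ.* + 3) (+ (2 * n) ℤ.* + c))
    where
    lemma : ∀ a b → ℤ.- (a ℤ.- b) ≡ b ℤ.- a
    lemma = ℤ-Solver.solve-∀
  -- Before any pruning every vertex is fresh.
  dich : Dichotomy i (Good G (λ _ → fresh))
  dich = subst (λ z → Dichotomy (im z) (Good G (λ _ → fresh))) (Z-fresh G)
    (forest-claim n G (λ _ → fresh) forest (noIsolated⇒ G ni))
  c-pos : 0ℤ ℤ.< + c
  c-pos = subst (λ z → 0ℤ ℤ.< re z) (Z-fresh G) (↓ Z-pos G {λ _ → weight fresh} (λ _ → weight-admissible fresh))
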